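{- Let $q$ be a prime power. The minimum distance of the polar orthogonal Grassmann code $C(\mathbb{O}_{3,6})$ over $\mathbb{F}_q$ is $$d(C(\mathbb{O}_{3,6}))=\begin{cases} q^3, & q \text{ even},\\ q^3-q^2, & q \text{ odd}.\end{cases}$$
   Context: Let $\mathbb{F}_q$ be the field with $q$ elements and $V=\mathbb{F}_q^6$, with the bilinear form $B(x,y)=\sum_{i=1}^{6}x_iy_{7-i}$ and the quadratic form $Q(x)=x_1x_6+x_2x_5+x_3x_4$. The polar orthogonal Grassmannian $\mathbb{O}_{3,6}$ is the set of all $3$-dimensional subspaces $W\subseteq V$ such that $B(v,w)=0$ and $Q(v)=0$ for all $v,w\in W$. For a $3$-element subset $I\subseteq\{1,\dots,6\}$ and a $3\times 6$ matrix $M$, $\det_I(M)$ is the determinant of the $3\times3$ submatrix of $M$ formed by the columns indexed by $I$ (in increasing order). Let $\Delta(3,6)$ be the set of all formal linear combinations $f=\sum_I c_I\det_I(\mathbf{X})$, with $c_I\in\mathbb{F}_q$ and $\mathbf{X}$ a generic $3\times 6$ matrix. Choose, for each $W\in\mathbb{O}_{3,6}$, exactly one $3\times 6$ matrix $M_W$ over $\mathbb{F}_q$ with row space $W$, and let $L=\{M_1,\dots,M_n\}$ be the resulting list of matrices. For $f\in\Delta(3,6)$ put $ev_L(f)=(f(M_1),\dots,f(M_n))\in\mathbb{F}_q^n$. The polar orthogonal Grassmann code is $C(\mathbb{O}_{3,6})=\{ev_L(f) : f\in\Delta(3,6)\}$. Its minimum distance is the minimum Hamming weight of a nonzero codeword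 (this does not depend on the choice of representatives). -}

module Defs where

open import Level using (0ℓ)
open import Algebra.Bundles using (CommutativeRing)
open import Algebra.Structures using (IsCommutativeRing)
open import Data.Bool.Base using (true; false)
open import Data.Fin.Base using (Fin; zero; suc; opposite)
open import Data.Fin.Patterns using (0F; 1F; 2F; 3F; 4F; 5F)
import Data.Fin.Properties as Fin
open import Data.Fin.Subset using (Subset; inside; outside; ∣_∣)
open import Data.List.Base as List using (List)
import Data.Maybe.Base as Maybe
open import Data.Nat.Base as ℕ using (ℕ; zero; suc; _^_; _≥_)
open import Data.Nat.Primality using (Prime)
import Data.Nat.Properties as ℕ
open import Data.Product.Base using (Σ-syntax; ∃; ∃₂; _×_; _,_)
open import Data.Product using (∃!)
open import Data.Vec.Base as Vec using (Vec; []; _∷_; lookup; tabulate)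
open import Function.Bundles using (_↔_)
open import Function.Properties.Inverse using (↔⇒↣)
open import Relation.Binary.Definitions using (DecidableEquality)
open import Relation.Binary.PropositionalEquality
  using (_≡_; _≢_; subst)
open import Relation.Nullary.Decidable using (dec⇒maybe; ¬?; via-injection)
open import Relation.Unary using (Pred; _∈_; _≐_)

IsPrimePower : ℕ → Set
IsPrimePower q = ∃₂ λ p k → Prime p × k ≥ 1 × q ≡ p ^ k

record FiniteField (q : ℕ) : Set₁ where
  infix  8 -_
  infixl 7 _*_
  infixl 6 _+_
  field
    Carrier           : Set
    _+_ _*_           : Carrier → Carrier → Carrier
    -_                : Carrier → Carrier
    0# 1#             : Carrier
    isCommutativeRing : IsCommutativeRing _≡_ _+_ _*_ -_ 0# 1#
    0≢1               : 0# ≢ 1#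
    inverse           : ∀ x → x ≢ 0# → ∃ λ y → x * y ≡ 1#
    finite            : Carrier ↔ Fin q

  open IsCommutativeRing isCommutativeRing public

  commutativeRing : CommutativeRing 0ℓ 0ℓ
  commutativeRing = record { isCommutativeRing = isCommutativeRing }

  infix 4 _≟_
  _≟_ : DecidableEquality Carrier
  _≟_ = via-injection (↔⇒↣ finite) Fin._≟_

-- The elements of a subset, in increasing order.
elements : ∀ {n} (I : Subset n) → Vec (Fin n) ∣ I ∣
elements []          = []
elements (true  ∷ I) = zero ∷ Vec.map suc (elements I)
elements (false ∷ I) = Vec.map suc (elements I)

KSubset : ℕ → ℕ → Set
KSubset k n = Σ[ I ∈ Subset n ] ∣ I ∣ ≡ k

allSubsets : ∀ n → List (Subset n)
allSubsets zero    = List.[ [] ]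
allSubsets (suc n) =
  List.map (inside ∷_) (allSubsets n) List.++ List.map (outside ∷_) (allSubsets n)

-- Every k-element subset of Fin n, listed exactly once.
allKSubsets : ∀ k n → List (KSubset k n)
allKSubsets k n =
  List.mapMaybe (λ I → Maybe.map (I ,_) (dec⇒maybe (∣ I ∣ ℕ.≟ k))) (allSubsets n)

module _ {q : ℕ} (F : FiniteField q) where
  open FiniteField F

  Vector : ℕ → Set
  Vector n = Vec Carrier n

  -- A k × n matrix, as the vector of its rows.
  Matrix : ℕ → ℕ → Set
  Matrix k n = Vec (Vector n) k

  sumᴸ : List Carrier → Carrier
  sumᴸ = List.foldr _+_ 0#

  sumⱽ : ∀ {n} → Vector n → Carrier
  sumⱽ = Vec.foldr _ _+_ 0#

  0ᵛ : ∀ {n} → Vector n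
  0ᵛ = Vec.replicate _ 0#

  infixl 6 _+ᵛ_
  _+ᵛ_ : ∀ {n} → Vector n → Vector n → Vector n
  _+ᵛ_ = Vec.zipWith _+_

  infixr 7 _·ᵛ_
  _·ᵛ_ : ∀ {n} → Carrier → Vector n → Vector n
  a ·ᵛ v = Vec.map (a *_) v

  linearCombination : ∀ {k n} → Vector k → Vec (Vector n) k → Vector n
  linearCombination as vs = Vec.foldr _ _+ᵛ_ 0ᵛ (Vec.zipWith _·ᵛ_ as vs)

  Span : ∀ {k n} → Vec (Vector n) k → Pred (Vector n) 0ℓ
  Span vs v = ∃ λ as → linearCombination as vs ≡ v

  LinearlyIndependent : ∀ {k n} → Vec (Vector n) k → Set
  LinearlyIndependent vs = ∀ as → linearCombination as vs ≡ 0ᵛ → as ≡ 0ᵛ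

  record IsSubspace {n} (W : Pred (Vector n) 0ℓ) : Set where
    field
      0-closed : 0ᵛ ∈ W
      +-closed : ∀ {v w} → v ∈ W → w ∈ W → v +ᵛ w ∈ W
      ·-closed : ∀ a {v} → v ∈ W → a ·ᵛ v ∈ W

  HasDimension : ∀ {n} → Pred (Vector n) 0ℓ → ℕ → Set
  HasDimension {n} W k =
    Σ[ basis ∈ Vec (Vector n) k ] LinearlyIndependent basis × Span basis ≐ W

  rowSpace : ∀ {k n} → Matrix k n → Pred (Vector n) 0ℓ
  rowSpace = Span

  -- With 0-based indices, `opposite` sends i to 5 − i.
  B : Vector 6 → Vector 6 → Carrier
  B x y = sumⱽ (tabulate λ i → lookup x i * lookup y (opposite i))

  Q : Vector 6 → Carrier
  Q x = lookup x 0F * lookup x 5F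
      + lookup x 1F * lookup x 4F
      + lookup x 2F * lookup x 3F

  record 𝕆₃,₆ (W : Pred (Vector 6) 0ℓ) : Set where
    field
      isSubspace  : IsSubspace W
      dimension   : HasDimension W 3
      B-isotropic : ∀ {v w} → v ∈ W → w ∈ W → B v w ≡ 0#
      Q-singular  : ∀ {v} → v ∈ W → Q v ≡ 0#

  det₃ : Matrix 3 3 → Carrier
  det₃ ((a ∷ b ∷ c ∷ []) ∷ (d ∷ e ∷ f ∷ []) ∷ (g ∷ h ∷ i ∷ []) ∷ []) =
    a * (e * i - f * h) - b * (d * i - f * g) + c * (d * h - e * g)

  selectColumns : ∀ {m k n} → KSubset k n → Matrix m n → Matrix m k
  selectColumns (I , ∣I∣≡k) =
    Vec.map λ row → Vec.map (lookup row) (subst (Vec _) ∣I∣≡k (elements I))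

  det[_] : KSubset 3 6 → Matrix 3 6 → Carrier
  det[ I ] M = det₃ (selectColumns I M)

  -- A formal linear combination Σ c_I det_I is its family of coefficients.
  Δ₃,₆ : Set
  Δ₃,₆ = KSubset 3 6 → Carrier

  evaluate : Δ₃,₆ → Matrix 3 6 → Carrier
  evaluate c M = sumᴸ (List.map (λ I → c I * det[ I ] M) (allKSubsets 3 6))

  ev : ∀ {n} → Vec (Matrix 3 6) n → Δ₃,₆ → Vector n
  ev L f = Vec.map (evaluate f) L

  -- L contains exactly one matrix M_W with row space W for each W ∈ 𝕆₃,₆,
  -- and nothing else.
  record IsListOfRepresentatives {n} (L : Vec (Matrix 3 6) n) : Set₁ where
    field
      sound  : ∀ i → 𝕆₃,₆ (rowSpace (lookup L i))
      unique : ∀ W → 𝕆₃,₆ W → ∃! _≡_ λ i → rowSpace (lookup L i) ≐ W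

  polarOrthogonalGrassmannCode : ∀ {n} → Vec (Matrix 3 6) n → Pred (Vector n) 0ℓ
  polarOrthogonalGrassmannCode L x = ∃ λ f → ev L f ≡ x

  hammingWeight : ∀ {n} → Vector n → ℕ
  hammingWeight = Vec.count (λ x → ¬? (x ≟ 0#))

  record IsMinimumDistance {n} (C : Pred (Vector n) 0ℓ) (d : ℕ) : Set where
    field
      attained   : ∃ λ x → x ∈ C × x ≢ 0ᵛ × hammingWeight x ≡ d
      lowerBound : ∀ {x} → x ∈ C → x ≢ 0ᵛ → d ℕ.≤ hammingWeight x

{-# OPTIONS --safe #-}
module Submission where

-- Klein's correspondence identifies V with Λ²F⁴, the points x of P(F⁴) with the
-- members W_x = {x ∧ u} of one family of maximal singular subspaces, and reversing
-- the coordinates gives the other family.  On either family a combination f of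
-- minors becomes a quadratic form in x, so the weight of f is the number of
-- projective points at which its two forms Q⁺, Q⁻ do not vanish.  A nonzero
-- quadratic form on F⁴ has at least q²(q − 1)² nonzeros: if x is a zero with
-- B(x,·) ≠ 0, then every line parallel to x through a v with B(x,v) ≠ 0 contains
-- exactly one zero; if there is no such x, every line parallel to a nonzero w of
-- the form contains at most one zero, which even gives q³(q − 1).  This settles
-- odd q, where p₁₂₅ + p₁₃₄ = −2x₀x₁ attains the bound.  In characteristic 2 the
-- forms Q⁺ and Q⁻ have the same mixed coefficients up to relabelling; so either
-- both are nonzero, or the remaining one has zero polarisation, and both cases
-- give q³, the weight of p₁₂₃ = x₀².

-- That the two families exhaust the polar Grassmannian is never shown; three weaker facts replace
-- it. Lower bounds need only that different points, of either family, give different positions in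
-- the list. Upper bounds need only that a subspace with p₁₂₃ ≠ 0 is some W_x with x₀ = 1, which row
-- reduction gives. Lastly, Q⁺ = Q⁻ = 0 must make f vanish on every isotropic matrix M, whatever its
-- family. This rests on relations among the minors of M: combining the rows of M with the cross
-- product of two columns as coefficients gives a vector whose entries are minors, so B of two such
-- vectors is a quadratic relation. It yields m² = m′² for the minors m = {a,b,b′} and m′ =
-- {a,c,c′}, where b′, c′ are the partners 7 - b, 7 - c; the family decides the sign in m = ±m′. Up
-- to sign, Q⁺ and Q⁻ carry the sum and the difference of the coefficients of m and m′, so both
-- being zero settles all characteristics at once. Each point accounts for q - 1 vectors, so vector
-- counts are divided by q - 1. Two nonzero forms in characteristic 2 then give 2q²(q - 1) ≥ q³,
-- because q ≥ 2.

open import Defs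
open import Algebra.Bundles using (CommutativeRing)
open import Data.Bool.Base using (Bool; true; false; not; if_then_else_; _∧_; T)
import Data.Bool.Properties as Bool
open import Data.Fin using (#_)
open import Data.Fin.Base using (Fin; zero; suc; toℕ; opposite; punchIn; punchOut; _↑ˡ_; _↑ʳ_)
open import Data.Fin.Patterns using (0F; 1F; 2F; 3F; 4F; 5F)
open import Data.Fin.Permutation using (Permutation′; permutation; _⟨$⟩ʳ_)
import Data.Fin.Properties as Fin
open import Data.Fin.Subset using (Subset; inside; outside)
open import Data.List.Base as List using (List; []; _∷_)
import Data.List.Properties as List
open import Data.List.Membership.Propositional using (_∈_; lose)
open import Data.List.Membership.Propositional.Properties
  using ( ∈-lookup; ∈-filter⁺; ∈-filter⁻; ∈-cartesianProduct⁺; ∈-cartesianProduct⁻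
        ; ∈-cartesianProductWith⁺; ∈-map⁺; ∈-map⁻; ∈-++⁻; ∈-allFin)
open import Data.List.Relation.Unary.All as All using (All)
open import Data.List.Relation.Unary.AllPairs using ([]; _∷_)
open import Data.List.Relation.Unary.Any as Any using (Any; here)
open import Data.List.Relation.Unary.Any.Properties using (lookup-index)
open import Data.List.Relation.Unary.Unique.Propositional using (Unique)
import Data.List.Relation.Unary.Unique.Propositional.Properties as Unique
open import Data.Nat.Base as ℕ using (ℕ; zero; suc; _^_; _∸_)
open import Data.Nat.Divisibility using (_∣_; _∤_; divides; ∣1⇒≡1)
open import Data.Nat.DivMod using (_%_; _/_; m≡m%n+[m/n]*n; m%n<n)
open import Data.Nat.Primality using (euclidsLemma; prime⇒irreducible; prime[2])
import Data.Nat.Properties as ℕ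
open import Data.Product.Base using (∃; _×_; _,_; proj₁; proj₂)
open import Data.Sum.Base using (_⊎_; inj₁; inj₂)
open import Data.Empty using (⊥-elim)
open import Data.Unit.Base using (⊤; tt)
open import Data.Vec.Base as Vec using (Vec; []; _∷_; lookup; _++_)
open import Data.Vec.N-ary using (N-ary; _$ⁿ_)
import Data.Vec.Properties as Vec
open import Function.Base using (_∘_)
open import Function.Bundles using (_↔_; module Inverse)
open import Level using (0ℓ)
open import Relation.Binary.PropositionalEquality
open import Relation.Nullary using (¬_; Dec; yes; no; contradiction; does)
open import Relation.Nullary.Decidable using (¬?; decidable-stable; map′; _×-dec_)
open import Relation.Unary using (Pred; Decidable; _⊆_; _≐_)
open import Relation.Unary.Properties using (≐-sym; ≐-trans)

-- Formulas of the exterior algebra of F⁴ and of its quadratic forms.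

-- Stated over arbitrary operations so that the same definition yields both the
-- field element and the expression denoting it.
module Formulas {A : Set} (_+_ _*_ : A → A → A) (-_ : A → A) (0# 1# : A) where
  private
    _-_ : A → A → A
    x - y = x + (- y)
    infixl 6 _-_

  lincomb : ∀ {k n} → Vec A k → Vec (Vec A n) k → Vec A n
  lincomb as vs = Vec.foldr _ (Vec.zipWith _+_) (Vec.replicate _ 0#)
                    (Vec.zipWith (λ a → Vec.map (a *_)) as vs)

  bilinear : Vec A 6 → Vec A 6 → A
  bilinear x y =
    Vec.foldr _ _+_ 0# (Vec.tabulate λ i → lookup x i * lookup y (opposite i))

  quadric : Vec A 6 → A
  quadric x = ((lookup x 0F * lookup x 5F) + (lookup x 1F * lookup x 4F)) + (lookup x 2F * lookup x 3F)

  determinant : Vec (Vec A 3) 3 → A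
  determinant ((a ∷ b ∷ c ∷ []) ∷ (d ∷ e ∷ f ∷ []) ∷ (g ∷ h ∷ i ∷ []) ∷ []) =
    ((a * ((e * i) - (f * h))) - (b * ((d * i) - (f * g)))) + (c * ((d * h) - (e * g)))

  minor : KSubset 3 6 → Vec (Vec A 6) 3 → A
  minor (I , ∣I∣≡3) M =
    determinant (Vec.map (λ row → Vec.map (lookup row) (subst (Vec _) ∣I∣≡3 (elements I))) M)

  combination : Vec A 20 → Vec (Vec A 6) 3 → A
  combination c M =
    List.foldr _+_ 0# (List.zipWith (λ a I → a * minor I M) (Vec.toList c) (allKSubsets 3 6))

  -- The coordinates are (p₀₁,p₀₂,p₀₃,p₁₂,p₃₁,p₂₃): with p₃₁ in place of p₁₃ the
  -- Plücker relation p₀₁p₂₃ + p₀₂p₃₁ + p₀₃p₁₂ = 0 is the vanishing of the quadric.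
  wedge : Vec A 4 → Vec A 4 → Vec A 6
  wedge (x₀ ∷ x₁ ∷ x₂ ∷ x₃ ∷ []) (y₀ ∷ y₁ ∷ y₂ ∷ y₃ ∷ []) =
    ((x₀ * y₁) - (x₁ * y₀)) ∷ ((x₀ * y₂) - (x₂ * y₀)) ∷ ((x₀ * y₃) - (x₃ * y₀)) ∷
    ((x₁ * y₂) - (x₂ * y₁)) ∷ ((x₃ * y₁) - (x₁ * y₃)) ∷ ((x₂ * y₃) - (x₃ * y₂)) ∷ []

  -- The two families of maximal singular subspaces are exchanged by reversing
  -- the coordinates.
  reversed : Bool → Vec A 6 → Vec A 6
  reversed true  z                                   = z
  reversed false (z₁ ∷ z₂ ∷ z₃ ∷ z₄ ∷ z₅ ∷ z₆ ∷ []) = z₆ ∷ z₅ ∷ z₄ ∷ z₃ ∷ z₂ ∷ z₁ ∷ []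

  ω : Bool → Vec A 4 → Vec A 4 → Vec A 6
  ω b x y = reversed b (wedge x y)

  -- The rows are x ∧ eₖ for k ≠ j, reversed for the second family. As x ∧ x = 0, they span all x ∧
  -- u as soon as xⱼ ≠ 0.
  generator : Bool → Fin 4 → Vec A 4 → Vec (Vec A 6) 3
  generator b j x =
    row (1# ∷ 0# ∷ 0# ∷ []) ∷ row (0# ∷ 1# ∷ 0# ∷ []) ∷ row (0# ∷ 0# ∷ 1# ∷ []) ∷ []
    where
    row : Vec A 3 → Vec A 6
    row u = ω b x (Vec.insertAt u j 0#)

  quadratic : Vec A 10 → Vec A 4 → A
  quadratic (α₀ ∷ α₁ ∷ α₂ ∷ α₃ ∷ β₀₁ ∷ β₀₂ ∷ β₀₃ ∷ β₁₂ ∷ β₁₃ ∷ β₂₃ ∷ []) (x₀ ∷ x₁ ∷ x₂ ∷ x₃ ∷ []) =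
    (α₀ * (x₀ * x₀)) + ((α₁ * (x₁ * x₁)) + ((α₂ * (x₂ * x₂)) + ((α₃ * (x₃ * x₃)) +
    ((β₀₁ * (x₀ * x₁)) + ((β₀₂ * (x₀ * x₂)) + ((β₀₃ * (x₀ * x₃)) +
    ((β₁₂ * (x₁ * x₂)) + ((β₁₃ * (x₁ * x₃)) + (β₂₃ * (x₂ * x₃))))))))))

  signed : Fin 4 → A → A
  signed 0F a = a
  signed 1F a = - a
  signed 2F a = a
  signed 3F a = - a

  -- Up to the sign of `signed j`, every minor of `generator b j x` is zero or ±xⱼ
  -- times a monomial of degree 2: a square for 4 of the 20 minors, a product of two
  -- different coordinates for 12.
  coefficients : Bool → Vec A 20 → Vec A 10
  coefficients true (c₁₂₃ ∷ c₁₂₄ ∷ c₁₂₅ ∷ c₁₂₆ ∷ c₁₃₄ ∷ c₁₃₅ ∷ c₁₃₆ ∷ c₁₄₅ ∷ c₁₄₆ ∷ c₁₅₆ ∷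
                     c₂₃₄ ∷ c₂₃₅ ∷ c₂₃₆ ∷ c₂₄₅ ∷ c₂₄₆ ∷ c₂₅₆ ∷ c₃₄₅ ∷ c₃₄₆ ∷ c₃₅₆ ∷ c₄₅₆ ∷ []) =
    c₁₂₃ ∷ (- c₁₄₅) ∷ c₂₄₆ ∷ (- c₃₅₆) ∷
    (- (c₁₂₅ + c₁₃₄)) ∷ (c₁₂₆ - c₂₃₄) ∷ (c₁₃₆ + c₂₃₅) ∷
    (c₁₄₆ - c₂₄₅) ∷ (- (c₁₅₆ + c₃₄₅)) ∷ (c₃₄₆ - c₂₅₆) ∷ []
  coefficients false (c₁₂₃ ∷ c₁₂₄ ∷ c₁₂₅ ∷ c₁₂₆ ∷ c₁₃₄ ∷ c₁₃₅ ∷ c₁₃₆ ∷ c₁₄₅ ∷ c₁₄₆ ∷ c₁₅₆ ∷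
                      c₂₃₄ ∷ c₂₃₅ ∷ c₂₃₆ ∷ c₂₄₅ ∷ c₂₄₆ ∷ c₂₅₆ ∷ c₃₄₅ ∷ c₃₄₆ ∷ c₃₅₆ ∷ c₄₅₆ ∷ []) =
    (- c₄₅₆) ∷ c₂₃₆ ∷ (- c₁₃₅) ∷ c₁₂₄ ∷
    (c₂₅₆ + c₃₄₆) ∷ (c₃₄₅ - c₁₅₆) ∷ (- (c₁₄₆ + c₂₄₅)) ∷
    (c₂₃₅ - c₁₃₆) ∷ (c₁₂₆ + c₂₃₄) ∷ (c₁₂₅ - c₁₃₄) ∷ []

  polar : Vec A 10 → Vec A 4 → Vec A 4 → A
  polar (α₀ ∷ α₁ ∷ α₂ ∷ α₃ ∷ β₀₁ ∷ β₀₂ ∷ β₀₃ ∷ β₁₂ ∷ β₁₃ ∷ β₂₃ ∷ [])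
        (x₀ ∷ x₁ ∷ x₂ ∷ x₃ ∷ []) (y₀ ∷ y₁ ∷ y₂ ∷ y₃ ∷ []) =
    (2* (α₀ * (x₀ * y₀))) + ((2* (α₁ * (x₁ * y₁))) + ((2* (α₂ * (x₂ * y₂))) + ((2* (α₃ * (x₃ * y₃))) +
    ((β₀₁ * ((x₀ * y₁) + (x₁ * y₀))) + ((β₀₂ * ((x₀ * y₂) + (x₂ * y₀))) +
    ((β₀₃ * ((x₀ * y₃) + (x₃ * y₀))) + ((β₁₂ * ((x₁ * y₂) + (x₂ * y₁))) +
    ((β₁₃ * ((x₁ * y₃) + (x₃ * y₁))) + (β₂₃ * ((x₂ * y₃) + (x₃ * y₂)))))))))))
    where
    2* : A → A
    2* a = a + a

  -- The exterior product x ∧ z in Λ³F⁴, with coordinates 012, 013, 023, 123. It detects membership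
  -- in W_x: it vanishes for z = x ∧ u.
  wedge₃ : Vec A 4 → Vec A 6 → Vec A 4
  wedge₃ (x₀ ∷ x₁ ∷ x₂ ∷ x₃ ∷ []) (z₁ ∷ z₂ ∷ z₃ ∷ z₄ ∷ z₅ ∷ z₆ ∷ []) =
    (((x₀ * z₄) - (x₁ * z₂)) + (x₂ * z₁)) ∷ (((x₃ * z₁) - (x₀ * z₅)) - (x₁ * z₃)) ∷
    (((x₀ * z₆) - (x₂ * z₃)) + (x₃ * z₂)) ∷ (((x₁ * z₆) + (x₂ * z₅)) + (x₃ * z₄)) ∷ []

  column : ∀ {n} → Fin n → Vec (Vec A n) 3 → Vec A 3
  column i = Vec.map (λ r → lookup r i)

  cross : Vec A 3 → Vec A 3 → Vec A 3
  cross (a₀ ∷ a₁ ∷ a₂ ∷ []) (b₀ ∷ b₁ ∷ b₂ ∷ []) =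
    ((a₁ * b₂) - (a₂ * b₁)) ∷ ((a₂ * b₀) - (a₀ * b₂)) ∷ ((a₀ * b₁) - (a₁ * b₀)) ∷ []

  -- Entry c of the first argument of `bilinear` is det(mᵢ, mⱼ, m_c), where the m's are the columns
  -- of M, and likewise with k, l for the second. The value is thus a quadratic polynomial in the
  -- minors of M that vanishes when M is isotropic.
  crossForm : Fin 6 → Fin 6 → Fin 6 → Fin 6 → Vec (Vec A 6) 3 → A
  crossForm i j k l M =
    bilinear (lincomb (cross (column i M) (column j M)) M)
             (lincomb (cross (column k M) (column l M)) M)

  -- For d = 1 / det X this is the inverse of X: the crosses of the columns are the rows of the
  -- adjugate.
  scaledAdjugate : A → Vec (Vec A 3) 3 → Vec (Vec A 3) 3
  scaledAdjugate d X = Vec.map (Vec.map (d *_))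
    (cross (column 1F X) (column 2F X) ∷ cross (column 2F X) (column 0F X) ∷
     cross (column 0F X) (column 1F X) ∷ [])

  matrix : Vec A 18 → Vec (Vec A 6) 3
  matrix (a₁ ∷ a₂ ∷ a₃ ∷ a₄ ∷ a₅ ∷ a₆ ∷ b₁ ∷ b₂ ∷ b₃ ∷ b₄ ∷ b₅ ∷ b₆ ∷ c₁ ∷ c₂ ∷ c₃ ∷ c₄ ∷ c₅ ∷ c₆ ∷ []) =
    (a₁ ∷ a₂ ∷ a₃ ∷ a₄ ∷ a₅ ∷ a₆ ∷ []) ∷ (b₁ ∷ b₂ ∷ b₃ ∷ b₄ ∷ b₅ ∷ b₆ ∷ []) ∷
    (c₁ ∷ c₂ ∷ c₃ ∷ c₄ ∷ c₅ ∷ c₆ ∷ []) ∷ []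

-- A reflective decision procedure for polynomial identities.

infixl 6 _:+_ _:-_
infixl 7 _:*_
infix  8 :-_
infix  4 _:=_

data Expr : Set where
  var       : ℕ → Expr
  :0 :1     : Expr
  _:+_ _:*_ : Expr → Expr → Expr
  :-_       : Expr → Expr

_:-_ : Expr → Expr → Expr
e :- f = e :+ :- f

_:=_ : {A : Set} → A → A → A × A
_:=_ = _,_

-- A sorted list of variables; a polynomial without negative coefficients is a
-- list of monomials with repetitions.
Monomial Positive : Set
Monomial = List ℕ
Positive = List Monomial

_≤ᵐ_ : Monomial → Monomial → Bool
[]      ≤ᵐ _       = true
(_ ∷ _) ≤ᵐ []      = false
(i ∷ m) ≤ᵐ (j ∷ n) = if i ℕ.<ᵇ j then true else (if i ℕ.≡ᵇ j then m ≤ᵐ n else false)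

merge : {A : Set} → (A → A → Bool) → List A → List A → List A
merge _≤_ []       ys       = ys
merge _≤_ (x ∷ xs) []       = x ∷ xs
merge _≤_ (x ∷ xs) (y ∷ ys) =
  if x ≤ y then x ∷ merge _≤_ xs (y ∷ ys) else y ∷ merge _≤_ (x ∷ xs) ys

mergePairs : List Positive → List Positive
mergePairs (p ∷ q ∷ ps) = merge _≤ᵐ_ p q ∷ mergePairs ps
mergePairs ps           = ps

mergeAll : ℕ → List Positive → Positive
mergeAll zero    ps = List.foldr (merge _≤ᵐ_) [] ps
mergeAll (suc k) ps = mergeAll k (mergePairs ps)

-- Twelve rounds of pairwise merging bring 4096 monomials into one list; `mergeAll zero` merges
-- whatever remains, so the constant affects speed only.
sort : Positive → Positive
sort p = mergeAll 12 (List.map List.[_] p)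

_*ᵐ_ : Monomial → Monomial → Monomial
_*ᵐ_ = merge ℕ._≤ᵇ_

_*ᵖ_ : Positive → Positive → Positive
[]      *ᵖ q = []
(m ∷ p) *ᵖ q = List.map (m *ᵐ_) q List.++ (p *ᵖ q)

-- A pair (p , n) stands for p − n.
normalise : Expr → Positive × Positive
normalise (var i)  = ((i ∷ []) ∷ []) , []
normalise :0       = [] , []
normalise :1       = ([] ∷ []) , []
normalise (e :+ f) =
  let p , n = normalise e ; p′ , n′ = normalise f in p List.++ p′ , n List.++ n′
normalise (e :* f) =
  let p , n = normalise e ; p′ , n′ = normalise f in
  (p *ᵖ p′) List.++ (n *ᵖ n′) , (p *ᵖ n′) List.++ (n *ᵖ p′)
normalise (:- e)   = let p , n = normalise e in n , p

_≡ᵐ_ : Monomial → Monomial → Bool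
[]      ≡ᵐ []      = true
(i ∷ m) ≡ᵐ (j ∷ n) = (i ℕ.≡ᵇ j) ∧ (m ≡ᵐ n)
_       ≡ᵐ _       = false

_≡ᵖ_ : Positive → Positive → Bool
[]      ≡ᵖ []      = true
(m ∷ p) ≡ᵖ (n ∷ q) = (m ≡ᵐ n) ∧ (p ≡ᵖ q)
_       ≡ᵖ _       = false

same : Expr × Expr → Bool
same (e , f) =
  let p , n = normalise e ; p′ , n′ = normalise f in
  sort (p List.++ n′) ≡ᵖ sort (p′ List.++ n)

sameAll : ∀ {k} → Vec Expr k × Vec Expr k → Bool
sameAll ([]     , [])     = true
sameAll (e ∷ es , f ∷ fs) = same (e , f) ∧ sameAll (es , fs)

T-∧ : ∀ a {b} → T (a ∧ b) → T a × T b
T-∧ true t = tt , t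

≡ᵐ-sound : ∀ m n → T (m ≡ᵐ n) → m ≡ n
≡ᵐ-sound []      []      _ = refl
≡ᵐ-sound (i ∷ m) (j ∷ n) t =
  let i≡j , m≡n = T-∧ (i ℕ.≡ᵇ j) t in cong₂ _∷_ (ℕ.≡ᵇ⇒≡ i j i≡j) (≡ᵐ-sound m n m≡n)

≡ᵖ-sound : ∀ p q → T (p ≡ᵖ q) → p ≡ q
≡ᵖ-sound []      []      _ = refl
≡ᵖ-sound (m ∷ p) (n ∷ q) t =
  let m≡n , p≡q = T-∧ (m ≡ᵐ n) t in cong₂ _∷_ (≡ᵐ-sound m n m≡n) (≡ᵖ-sound p q p≡q)

module E = Formulas _:+_ _:*_ :-_ :0 :1

module Solve {q} (F : FiniteField q) where
  open FiniteField F hiding (refl; sym; trans; reflexive; zero)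
  open CommutativeRing commutativeRing using (ring; +-commutativeSemigroup; *-commutativeSemigroup)
  open import Algebra.Properties.CommutativeSemigroup +-commutativeSemigroup
    using () renaming (interchange to +-interchange; x∙yz≈y∙xz to swapˡ)
  open import Algebra.Properties.CommutativeSemigroup *-commutativeSemigroup
    using (x∙yz≈y∙xz)
  open import Algebra.Properties.Ring ring using (-‿distribˡ-*; -‿distribʳ-*; -‿involutive; -‿+-comm; -0#≈0#)
  open ≡-Reasoning

  module C = Formulas _+_ _*_ -_ 0# 1#

  -- 0# is a default for indices out of range; `variables n` stays within the range.
  at : ∀ {n} → Vec Carrier n → ℕ → Carrier
  at []      _       = 0#
  at (x ∷ _) zero    = x
  at (_ ∷ ρ) (suc i) = at ρ i

  module _ {n} (ρ : Vec Carrier n) where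
    ⟦_⟧ : Expr → Carrier
    ⟦ var i ⟧  = at ρ i
    ⟦ :0 ⟧     = 0#
    ⟦ :1 ⟧     = 1#
    ⟦ e :+ f ⟧ = ⟦ e ⟧ + ⟦ f ⟧
    ⟦ e :* f ⟧ = ⟦ e ⟧ * ⟦ f ⟧
    ⟦ :- e ⟧   = - ⟦ e ⟧

    ⟦_⟧ᵐ : Monomial → Carrier
    ⟦_⟧ᵐ = List.foldr (λ i → at ρ i *_) 1#

    ⟦_⟧ᵖ : Positive → Carrier
    ⟦_⟧ᵖ = List.foldr (λ m → ⟦ m ⟧ᵐ +_) 0#

    ⟦_⟧ᵈ : Positive × Positive → Carrier
    ⟦ p , n ⟧ᵈ = ⟦ p ⟧ᵖ + - ⟦ n ⟧ᵖ

    ⟦merge⟧ᵐ : ∀ m n → ⟦ m *ᵐ n ⟧ᵐ ≡ ⟦ m ⟧ᵐ * ⟦ n ⟧ᵐ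
    ⟦merge⟧ᵐ []      n       = sym (*-identityˡ _)
    ⟦merge⟧ᵐ (i ∷ m) []      = sym (*-identityʳ _)
    ⟦merge⟧ᵐ (i ∷ m) (j ∷ n) = choose (i ℕ.≤ᵇ j) (⟦merge⟧ᵐ m (j ∷ n)) (⟦merge⟧ᵐ (i ∷ m) n)
      where
      choose : ∀ b {u v} → ⟦ u ⟧ᵐ ≡ ⟦ m ⟧ᵐ * ⟦ j ∷ n ⟧ᵐ → ⟦ v ⟧ᵐ ≡ ⟦ i ∷ m ⟧ᵐ * ⟦ n ⟧ᵐ →
               ⟦ if b then i ∷ u else j ∷ v ⟧ᵐ ≡ ⟦ i ∷ m ⟧ᵐ * ⟦ j ∷ n ⟧ᵐ
      choose true  eq _  = trans (cong (at ρ i *_) eq) (sym (*-assoc _ _ _))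
      choose false _  eq = trans (cong (at ρ j *_) eq) (x∙yz≈y∙xz _ _ _)

    ⟦++⟧ : ∀ p q → ⟦ p List.++ q ⟧ᵖ ≡ ⟦ p ⟧ᵖ + ⟦ q ⟧ᵖ
    ⟦++⟧ []      q = sym (+-identityˡ _)
    ⟦++⟧ (m ∷ p) q = trans (cong (⟦ m ⟧ᵐ +_) (⟦++⟧ p q)) (sym (+-assoc _ _ _))

    ⟦merge⟧ᵖ : ∀ p q → ⟦ merge _≤ᵐ_ p q ⟧ᵖ ≡ ⟦ p ⟧ᵖ + ⟦ q ⟧ᵖ
    ⟦merge⟧ᵖ []      q       = sym (+-identityˡ _)
    ⟦merge⟧ᵖ (m ∷ p) []      = sym (+-identityʳ _)
    ⟦merge⟧ᵖ (m ∷ p) (n ∷ q) = choose (m ≤ᵐ n) (⟦merge⟧ᵖ p (n ∷ q)) (⟦merge⟧ᵖ (m ∷ p) q)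
      where
      choose : ∀ b {u v} → ⟦ u ⟧ᵖ ≡ ⟦ p ⟧ᵖ + ⟦ n ∷ q ⟧ᵖ → ⟦ v ⟧ᵖ ≡ ⟦ m ∷ p ⟧ᵖ + ⟦ q ⟧ᵖ →
               ⟦ if b then m ∷ u else n ∷ v ⟧ᵖ ≡ ⟦ m ∷ p ⟧ᵖ + ⟦ n ∷ q ⟧ᵖ
      choose true  eq _  = trans (cong (⟦ m ⟧ᵐ +_) eq) (sym (+-assoc _ _ _))
      choose false _  eq = trans (cong (⟦ n ⟧ᵐ +_) eq) (swapˡ _ _ _)

    ⟦_⟧ᵖˢ : List Positive → Carrier
    ⟦_⟧ᵖˢ = List.foldr (λ p → ⟦ p ⟧ᵖ +_) 0#

    ⟦mergePairs⟧ : ∀ ps → ⟦ mergePairs ps ⟧ᵖˢ ≡ ⟦ ps ⟧ᵖˢ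
    ⟦mergePairs⟧ []           = refl
    ⟦mergePairs⟧ (p ∷ [])     = refl
    ⟦mergePairs⟧ (p ∷ q ∷ ps) =
      trans (cong₂ _+_ (⟦merge⟧ᵖ p q) (⟦mergePairs⟧ ps)) (+-assoc _ _ _)

    ⟦mergeAll⟧ : ∀ k ps → ⟦ mergeAll k ps ⟧ᵖ ≡ ⟦ ps ⟧ᵖˢ
    ⟦mergeAll⟧ zero    []       = refl
    ⟦mergeAll⟧ zero    (p ∷ ps) =
      trans (⟦merge⟧ᵖ p (mergeAll zero ps)) (cong (⟦ p ⟧ᵖ +_) (⟦mergeAll⟧ zero ps))
    ⟦mergeAll⟧ (suc k) ps       = trans (⟦mergeAll⟧ k (mergePairs ps)) (⟦mergePairs⟧ ps)

    ⟦sort⟧ : ∀ p → ⟦ sort p ⟧ᵖ ≡ ⟦ p ⟧ᵖ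
    ⟦sort⟧ p = trans (⟦mergeAll⟧ 12 (List.map List.[_] p)) (singletons p)
      where
      singletons : ∀ p → ⟦ List.map List.[_] p ⟧ᵖˢ ≡ ⟦ p ⟧ᵖ
      singletons []      = refl
      singletons (m ∷ p) = cong₂ _+_ (+-identityʳ _) (singletons p)

    ⟦map*⟧ : ∀ m q → ⟦ List.map (m *ᵐ_) q ⟧ᵖ ≡ ⟦ m ⟧ᵐ * ⟦ q ⟧ᵖ
    ⟦map*⟧ m []      = sym (zeroʳ _)
    ⟦map*⟧ m (n ∷ q) = trans (cong₂ _+_ (⟦merge⟧ᵐ m n) (⟦map*⟧ m q)) (sym (distribˡ _ _ _))

    ⟦*⟧ᵖ : ∀ p q → ⟦ p *ᵖ q ⟧ᵖ ≡ ⟦ p ⟧ᵖ * ⟦ q ⟧ᵖ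
    ⟦*⟧ᵖ []      q = sym (zeroˡ _)
    ⟦*⟧ᵖ (m ∷ p) q = begin
      ⟦ List.map (m *ᵐ_) q List.++ (p *ᵖ q) ⟧ᵖ        ≡⟨ ⟦++⟧ (List.map (m *ᵐ_) q) (p *ᵖ q) ⟩
      ⟦ List.map (m *ᵐ_) q ⟧ᵖ + ⟦ p *ᵖ q ⟧ᵖ           ≡⟨ cong₂ _+_ (⟦map*⟧ m q) (⟦*⟧ᵖ p q) ⟩
      ⟦ m ⟧ᵐ * ⟦ q ⟧ᵖ + ⟦ p ⟧ᵖ * ⟦ q ⟧ᵖ               ≡⟨ distribʳ _ _ _ ⟨
      (⟦ m ⟧ᵐ + ⟦ p ⟧ᵖ) * ⟦ q ⟧ᵖ                       ∎

    -+ : ∀ x y → - (x + y) ≡ - x + - y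
    -+ x y = sym (-‿+-comm x y)

    difference-+ : ∀ a b c d → (a + c) + - (b + d) ≡ (a + - b) + (c + - d)
    difference-+ a b c d = trans (cong (a + c +_) (-+ b d)) (+-interchange a c (- b) (- d))

    difference-* : ∀ a b c d →
      (a * c + b * d) + - (a * d + b * c) ≡ (a + - b) * (c + - d)
    difference-* a b c d = begin
      (a * c + b * d) + - (a * d + b * c)     ≡⟨ difference-+ (a * c) (a * d) (b * d) (b * c) ⟩
      (a * c + - (a * d)) + (b * d + - (b * c)) ≡⟨ cong₂ _+_ (cong (a * c +_) (-‿distribʳ-* a d)) (+-comm (b * d) _) ⟩
      (a * c + a * - d) + (- (b * c) + b * d) ≡⟨ cong₂ _+_ (sym (distribˡ a c (- d))) (cong₂ _+_ (-‿distribˡ-* b c) bd≡-b*-d) ⟩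
      a * (c + - d) + (- b * c + - b * - d)   ≡⟨ cong (a * (c + - d) +_) (distribˡ (- b) c (- d)) ⟨
      a * (c + - d) + - b * (c + - d)         ≡⟨ distribʳ (c + - d) a (- b) ⟨
      (a + - b) * (c + - d)                   ∎
      where
      bd≡-b*-d : b * d ≡ - b * - d
      bd≡-b*-d = trans (sym (-‿involutive _)) (trans (cong -_ (-‿distribˡ-* b d)) (-‿distribʳ-* (- b) d))

    ⟦normalise⟧ : ∀ e → ⟦ normalise e ⟧ᵈ ≡ ⟦ e ⟧
    ⟦normalise⟧ (var i)  = begin
      at ρ i * 1# + 0# + - 0# ≡⟨ cong₂ _+_ (+-identityʳ _) -0#≈0# ⟩
      at ρ i * 1# + 0#        ≡⟨ +-identityʳ _ ⟩
      at ρ i * 1#             ≡⟨ *-identityʳ _ ⟩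
      at ρ i                  ∎
    ⟦normalise⟧ :0       = -‿inverseʳ 0#
    ⟦normalise⟧ :1       = trans (cong₂ _+_ (+-identityʳ _) -0#≈0#) (+-identityʳ _)
    ⟦normalise⟧ (e :+ f) = let p , n = normalise e ; p′ , n′ = normalise f in begin
      ⟦ p List.++ p′ ⟧ᵖ + - ⟦ n List.++ n′ ⟧ᵖ        ≡⟨ cong₂ (λ x y → x + - y) (⟦++⟧ p p′) (⟦++⟧ n n′) ⟩
      (⟦ p ⟧ᵖ + ⟦ p′ ⟧ᵖ) + - (⟦ n ⟧ᵖ + ⟦ n′ ⟧ᵖ)      ≡⟨ difference-+ _ _ _ _ ⟩
      ⟦ normalise e ⟧ᵈ + ⟦ normalise f ⟧ᵈ            ≡⟨ cong₂ _+_ (⟦normalise⟧ e) (⟦normalise⟧ f) ⟩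
      ⟦ e ⟧ + ⟦ f ⟧                                  ∎
    ⟦normalise⟧ (e :* f) = let p , n = normalise e ; p′ , n′ = normalise f in begin
      ⟦ normalise (e :* f) ⟧ᵈ
        ≡⟨ cong₂ (λ x y → x + - y)
             (trans (⟦++⟧ (p *ᵖ p′) _) (cong₂ _+_ (⟦*⟧ᵖ p p′) (⟦*⟧ᵖ n n′)))
             (trans (⟦++⟧ (p *ᵖ n′) _) (cong₂ _+_ (⟦*⟧ᵖ p n′) (⟦*⟧ᵖ n p′))) ⟩
      (⟦ p ⟧ᵖ * ⟦ p′ ⟧ᵖ + ⟦ n ⟧ᵖ * ⟦ n′ ⟧ᵖ) + - (⟦ p ⟧ᵖ * ⟦ n′ ⟧ᵖ + ⟦ n ⟧ᵖ * ⟦ p′ ⟧ᵖ)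
        ≡⟨ difference-* _ _ _ _ ⟩
      ⟦ normalise e ⟧ᵈ * ⟦ normalise f ⟧ᵈ
        ≡⟨ cong₂ _*_ (⟦normalise⟧ e) (⟦normalise⟧ f) ⟩
      ⟦ e ⟧ * ⟦ f ⟧ ∎
    ⟦normalise⟧ (:- e)   = let p , n = normalise e in begin
      ⟦ n ⟧ᵖ + - ⟦ p ⟧ᵖ         ≡⟨ +-comm _ _ ⟩
      - ⟦ p ⟧ᵖ + ⟦ n ⟧ᵖ         ≡⟨ cong (- ⟦ p ⟧ᵖ +_) (-‿involutive _) ⟨
      - ⟦ p ⟧ᵖ + - - ⟦ n ⟧ᵖ     ≡⟨ -‿+-comm _ _ ⟩
      - ⟦ normalise e ⟧ᵈ        ≡⟨ cong -_ (⟦normalise⟧ e) ⟩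
      - ⟦ e ⟧                   ∎

    cross-difference : ∀ a b c d → a + d ≡ c + b → a + - b ≡ c + - d
    cross-difference a b c d eq = begin
      a + - b                 ≡⟨ +-identityʳ _ ⟨
      (a + - b) + 0#          ≡⟨ cong (a + - b +_) (-‿inverseʳ d) ⟨
      (a + - b) + (d + - d)   ≡⟨ +-interchange a (- b) d (- d) ⟩
      (a + d) + (- b + - d)   ≡⟨ cong (_+ (- b + - d)) eq ⟩
      (c + b) + (- b + - d)   ≡⟨ cong (c + b +_) (+-comm (- b) (- d)) ⟩
      (c + b) + (- d + - b)   ≡⟨ +-interchange c b (- d) (- b) ⟩
      (c + - d) + (b + - b)   ≡⟨ cong (c + - d +_) (-‿inverseʳ b) ⟩
      (c + - d) + 0#          ≡⟨ +-identityʳ _ ⟩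
      c + - d                 ∎

    same-sound : ∀ e f → T (same (e , f)) → ⟦ e ⟧ ≡ ⟦ f ⟧
    same-sound e f t =
      let p , n = normalise e ; p′ , n′ = normalise f in begin
      ⟦ e ⟧             ≡⟨ ⟦normalise⟧ e ⟨
      ⟦ p ⟧ᵖ + - ⟦ n ⟧ᵖ ≡⟨ cross-difference _ _ _ _ (begin
        ⟦ p ⟧ᵖ + ⟦ n′ ⟧ᵖ            ≡⟨ ⟦++⟧ p n′ ⟨
        ⟦ p List.++ n′ ⟧ᵖ           ≡⟨ ⟦sort⟧ (p List.++ n′) ⟨
        ⟦ sort (p List.++ n′) ⟧ᵖ    ≡⟨ cong ⟦_⟧ᵖ (≡ᵖ-sound (sort (p List.++ n′)) (sort (p′ List.++ n)) t) ⟩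
        ⟦ sort (p′ List.++ n) ⟧ᵖ    ≡⟨ ⟦sort⟧ (p′ List.++ n) ⟩
        ⟦ p′ List.++ n ⟧ᵖ           ≡⟨ ⟦++⟧ p′ n ⟩
        ⟦ p′ ⟧ᵖ + ⟦ n ⟧ᵖ            ∎) ⟩
      ⟦ p′ ⟧ᵖ + - ⟦ n′ ⟧ᵖ ≡⟨ ⟦normalise⟧ f ⟩
      ⟦ f ⟧             ∎

    sameAll-sound : ∀ {k} (es fs : Vec Expr k) → T (sameAll (es , fs)) →
                    Vec.map ⟦_⟧ es ≡ Vec.map ⟦_⟧ fs
    sameAll-sound []       []       _ = refl
    sameAll-sound (e ∷ es) (f ∷ fs) t =
      let e≡f , es≡fs = T-∧ (same (e , f)) t
      in cong₂ _∷_ (same-sound e f e≡f) (sameAll-sound es fs es≡fs)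

  variables : ∀ n → Vec Expr n
  variables n = Vec.tabulate (λ i → var (toℕ i))

  -- For a true identity the implicit argument computes to `⊤` and is filled in by eta. The two
  -- denotations unfold to the wanted field elements, since `E` and `C` are instances of the same
  -- `Formulas`.
  prove : ∀ {n} (f : Vec Expr n → Expr × Expr) (ρ : Vec Carrier n) →
          {T (same (f (variables n)))} →
          ⟦_⟧ ρ (proj₁ (f (variables n))) ≡ ⟦_⟧ ρ (proj₂ (f (variables n)))
  prove {n} f ρ {t} = same-sound ρ (proj₁ (f (variables n))) (proj₂ (f (variables n))) t

  solve : ∀ n (f : N-ary n Expr (Expr × Expr)) (ρ : Vec Carrier n) →
          {T (same (f $ⁿ variables n))} →
          ⟦_⟧ ρ (proj₁ (f $ⁿ variables n)) ≡ ⟦_⟧ ρ (proj₂ (f $ⁿ variables n))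
  solve n f ρ {t} = prove (f $ⁿ_) ρ {t}

  solveVec : ∀ n {k} (f : N-ary n Expr (Vec Expr k × Vec Expr k)) (ρ : Vec Carrier n) →
             {T (sameAll (f $ⁿ variables n))} →
             Vec.map (⟦_⟧ ρ) (proj₁ (f $ⁿ variables n)) ≡ Vec.map (⟦_⟧ ρ) (proj₂ (f $ⁿ variables n))
  solveVec n f ρ {t} = sameAll-sound ρ (proj₁ (f $ⁿ variables n)) (proj₂ (f $ⁿ variables n)) t

-- Counting with duplicate-free lists.

lookup-injective : ∀ {A : Set} {xs : List A} → Unique xs →
                   ∀ i j → List.lookup xs i ≡ List.lookup xs j → i ≡ j
lookup-injective (_ ∷ _)   zero    zero    _  = refl
lookup-injective (x≢ ∷ _)  zero    (suc j) eq = contradiction eq (All.lookup x≢ (∈-lookup j))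
lookup-injective (x≢ ∷ _)  (suc i) zero    eq = contradiction (sym eq) (All.lookup x≢ (∈-lookup i))
lookup-injective (_ ∷ xs!) (suc i) (suc j) eq = cong suc (lookup-injective xs! i j eq)

-- Choosing an image of each entry gives an injection between positions. A relation in place of a
-- function allows images that are only characterised, such as a position whose row space is a given
-- subspace.
length-≤ : ∀ {A B : Set} (R : A → B → Set) {xs ys} → Unique xs →
           (∀ {x} → x ∈ xs → ∃ λ y → y ∈ ys × R x y) →
           (∀ {x x′ y} → R x y → R x′ y → x ≡ x′) →
           List.length xs ℕ.≤ List.length ys
length-≤ R {xs} {ys} xs! total injective = Fin.injective⇒≤ {f = position} position-injective
  where
  image : ∀ i → ∃ λ y → y ∈ ys × R (List.lookup xs i) y
  image i = total (∈-lookup i)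

  position : Fin (List.length xs) → Fin (List.length ys)
  position i = Any.index (proj₁ (proj₂ (image i)))

  related : ∀ i → R (List.lookup xs i) (List.lookup ys (position i))
  related i = subst (R _) (lookup-index (proj₁ (proj₂ (image i)))) (proj₂ (proj₂ (image i)))

  position-injective : ∀ {i j} → position i ≡ position j → i ≡ j
  position-injective {i} {j} eq = lookup-injective xs! i j
    (injective (related i) (subst (R _ ∘ List.lookup ys) (sym eq) (related j)))

length-filter-tabulate : ∀ {A B : Set} {P : Pred A 0ℓ} (P? : Decidable P) (f : B → A) {n} (g : Fin n → B) →
  List.length (List.filter (P? ∘ f) (List.tabulate g)) ≡ Vec.count P? (Vec.tabulate (f ∘ g))
length-filter-tabulate P? f {zero}  g = refl
length-filter-tabulate P? f {suc n} g with P? (f (g zero))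
... | yes _ = cong suc (length-filter-tabulate P? f (g ∘ suc))
... | no  _ = length-filter-tabulate P? f (g ∘ suc)

length-cartesianProductWith : ∀ {A B C : Set} (f : A → B → C) xs ys →
  List.length (List.cartesianProductWith f xs ys) ≡ List.length xs ℕ.* List.length ys
length-cartesianProductWith f []       ys = refl
length-cartesianProductWith f (x ∷ xs) ys =
  trans (List.length-++ (List.map (f x) ys))
        (cong₂ ℕ._+_ (List.length-map (f x) ys) (length-cartesianProductWith f xs ys))

support : ∀ {A : Set} {P : Pred A 0ℓ} (P? : Decidable P) {n} → Vec A n → List (Fin n)
support P? xs = List.filter (λ i → P? (lookup xs i)) (List.allFin _)

length-support : ∀ {A : Set} {P : Pred A 0ℓ} (P? : Decidable P) {n} (xs : Vec A n) →
                 List.length (support P? xs) ≡ Vec.count P? xs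
length-support P? xs =
  trans (length-filter-tabulate P? (lookup xs) (λ i → i)) (cong (Vec.count P?) (Vec.tabulate∘lookup xs))

-- Arithmetic in a finite field and the enumeration of its vectors.

module FieldArithmetic {q} (F : FiniteField q) where
  open FiniteField F hiding (refl; sym; trans; reflexive; zero)
  open Solve F
  open CommutativeRing commutativeRing using (ring)
  open import Algebra.Properties.Ring ring using (+-cancelʳ)

  infixl 6 _+′_
  infixr 7 _·′_
  _+′_ : ∀ {n} → Vector F n → Vector F n → Vector F n
  _+′_ = _+ᵛ_ F
  _·′_ : ∀ {n} → Carrier → Vector F n → Vector F n
  _·′_ = _·ᵛ_ F

  *-cancelʳ-nonZero : ∀ {a b c} → c ≢ 0# → a * c ≡ b * c → a ≡ b
  *-cancelʳ-nonZero {a} {b} {c} c≢0 eq = let d , cd≡1 = inverse c c≢0 in begin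
    a           ≡⟨ *-identityʳ a ⟨
    a * 1#      ≡⟨ cong (a *_) cd≡1 ⟨
    a * (c * d) ≡⟨ *-assoc a c d ⟨
    a * c * d   ≡⟨ cong (_* d) eq ⟩
    b * c * d   ≡⟨ *-assoc b c d ⟩
    b * (c * d) ≡⟨ cong (b *_) cd≡1 ⟩
    b * 1#      ≡⟨ *-identityʳ b ⟩
    b           ∎
    where open ≡-Reasoning

  *-zero-split : ∀ {a b} → a * b ≡ 0# → a ≡ 0# ⊎ b ≡ 0#
  *-zero-split {a} {b} ab≡0 with b ≟ 0#
  ... | yes b≡0 = inj₂ b≡0
  ... | no  b≢0 = inj₁ (*-cancelʳ-nonZero b≢0 (trans ab≡0 (sym (zeroˡ b))))

  *-nonZero : ∀ {a b} → a ≢ 0# → b ≢ 0# → a * b ≢ 0#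
  *-nonZero a≢0 b≢0 ab≡0 with *-zero-split ab≡0
  ... | inj₁ a≡0 = a≢0 a≡0
  ... | inj₂ b≡0 = b≢0 b≡0

  +ᵛ-cancelʳ : ∀ {n} (u v w : Vector F n) → (u +′ w) ≡ (v +′ w) → u ≡ v
  +ᵛ-cancelʳ []      []      []      _  = refl
  +ᵛ-cancelʳ (a ∷ u) (b ∷ v) (c ∷ w) eq =
    cong₂ _∷_ (+-cancelʳ c a b (Vec.∷-injectiveˡ eq)) (+ᵛ-cancelʳ u v w (Vec.∷-injectiveʳ eq))

  scalars : List Carrier
  scalars = List.map (Inverse.from finite) (List.allFin q)

  from-injective : ∀ {i j} → Inverse.from finite i ≡ Inverse.from finite j → i ≡ j
  from-injective {i} {j} eq =
    trans (sym (Inverse.strictlyInverseˡ finite i)) (trans (cong (Inverse.to finite) eq) (Inverse.strictlyInverseˡ finite j))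

  scalars-unique : Unique scalars
  scalars-unique = Unique.map⁺ from-injective (Unique.allFin⁺ q)

  ∈-scalars : ∀ a → a ∈ scalars
  ∈-scalars a = subst (_∈ scalars) (Inverse.strictlyInverseʳ finite a)
    (∈-map⁺ (Inverse.from finite) (∈-allFin (Inverse.to finite a)))

  length-scalars : List.length scalars ≡ q
  length-scalars = trans (List.length-map _ (List.allFin q)) (List.length-tabulate (λ i → i))

  vectors : ∀ n → List (Vector F n)
  vectors zero    = List.[ [] ]
  vectors (suc n) = List.cartesianProductWith _∷_ scalars (vectors n)

  vectors-unique : ∀ n → Unique (vectors n)
  vectors-unique zero    = All.[] ∷ []
  vectors-unique (suc n) =
    Unique.cartesianProductWith⁺ _∷_ Vec.∷-injective scalars-unique (vectors-unique n)

  ∈-vectors : ∀ {n} (v : Vector F n) → v ∈ vectors n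
  ∈-vectors []      = here refl
  ∈-vectors (a ∷ v) = ∈-cartesianProductWith⁺ _∷_ (∈-scalars a) (∈-vectors v)

  length-vectors : ∀ n → List.length (vectors n) ≡ q ℕ.^ n
  length-vectors zero    = refl
  length-vectors (suc n) =
    trans (length-cartesianProductWith _∷_ scalars (vectors n))
          (cong₂ ℕ._*_ length-scalars (length-vectors n))

  ∃ᵛ? : ∀ {n} {P : Pred (Vector F n) 0ℓ} → Decidable P → Dec (∃ P)
  ∃ᵛ? P? = map′ Any.satisfied (λ (v , pv) → lose (∈-vectors v) pv) (Any.any? P? (vectors _))

  ♯_ : ∀ {n} {P : Pred (Vector F n) 0ℓ} → Decidable P → ℕ
  ♯ P? = List.length (List.filter P? (vectors _))

-- Nonzeros of quadratic forms in four variables, with q = p + 1.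

module Quadrics {p} (F : FiniteField (suc p)) where
  open FiniteField F hiding (refl; sym; trans; reflexive; zero)
  open FieldArithmetic F
  open Solve F
  open CommutativeRing commutativeRing using (ring)
  open import Algebra.Properties.Ring ring using (+-cancelˡ)
  open import Algebra.Properties.Group (CommutativeRing.+-group commutativeRing) using (x∙y⁻¹≈ε⇒x≈y)

  -- Lists the q - 1 elements different from `a` by skipping the index of `a`.
  others : Carrier → Fin p → Carrier
  others a k = Inverse.from finite (punchIn (Inverse.to finite a) k)

  others-injective : ∀ a {k l} → others a k ≡ others a l → k ≡ l
  others-injective a eq = Fin.punchIn-injective (Inverse.to finite a) _ _ (from-injective eq)

  others-≢ : ∀ a k → others a k ≢ a
  others-≢ a k eq = Fin.punchInᵢ≢i (Inverse.to finite a) k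
    (trans (sym (Inverse.strictlyInverseˡ finite _)) (cong (Inverse.to finite) eq))

  nonZeros : List Carrier
  nonZeros = List.map (others 0#) (List.allFin p)

  length-nonZeros : List.length nonZeros ≡ p
  length-nonZeros = trans (List.length-map _ (List.allFin p)) (List.length-tabulate (λ i → i))

  ∈-nonZeros : ∀ {a} → a ≢ 0# → a ∈ nonZeros
  ∈-nonZeros {a} a≢0 = subst (_∈ nonZeros) others≡a (∈-map⁺ (others 0#) (∈-allFin k))
    where
    0≢a : Inverse.to finite 0# ≢ Inverse.to finite a
    0≢a eq = a≢0 (trans (sym (Inverse.strictlyInverseʳ finite a))
      (trans (cong (Inverse.from finite) (sym eq)) (Inverse.strictlyInverseʳ finite 0#)))
    k : Fin p
    k = punchOut 0≢a
    others≡a : others 0# k ≡ a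
    others≡a = trans (cong (Inverse.from finite) (Fin.punchIn-punchOut 0≢a)) (Inverse.strictlyInverseʳ finite a)

  -- Double counting of the pairs (v , t) with v ∈ S and v + t w ∈ X: each v
  -- contributes at least q − 1 of them, and each point of X at most q.
  lines-count : ∀ {n} {S X : Pred (Vector F n) 0ℓ} (S? : Decidable S) (X? : Decidable X) w →
    (∀ v → S v → ∀ t t′ → ¬ X (v +′ t ·′ w) → ¬ X (v +′ t′ ·′ w) → t ≡ t′) →
    (♯ S?) ℕ.* p ℕ.≤ (♯ X?) ℕ.* suc p
  lines-count {n} {S} {X} S? X? w unique = subst₂ ℕ._≤_
    (trans (length-cartesianProductWith _,_ (List.filter S? (vectors n)) (List.allFin p))
           (cong ((♯ S?) ℕ.*_) (List.length-tabulate (λ i → i))))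
    (trans (length-cartesianProductWith _,_ (List.filter X? (vectors n)) scalars) (cong ((♯ X?) ℕ.*_) length-scalars))
    (length-≤ R (Unique.cartesianProduct⁺ (Unique.filter⁺ S? (vectors-unique n)) (Unique.allFin⁺ p)) total injective)
    where
    search : ∀ v → Dec (Any (λ t → ¬ X (v +′ t ·′ w)) scalars)
    search v = Any.any? (λ t → ¬? (X? (v +′ t ·′ w))) scalars

    exceptional : Vector F n → Carrier
    exceptional v with search v
    ... | yes found = proj₁ (Any.satisfied found)
    -- If the whole line lies in X, an arbitrary scalar is skipped, so that every line contributes
    -- exactly q - 1 pairs.
    ... | no  _     = 0#

    exceptional-spec : ∀ v → S v → ∀ t → t ≢ exceptional v → X (v +′ t ·′ w)
    exceptional-spec v v∈S t t≢ with search v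
    ... | yes found = decidable-stable (X? _) λ ∉X →
      t≢ (unique v v∈S t _ ∉X (proj₂ (Any.satisfied found)))
    ... | no  none  = decidable-stable (X? _) λ ∉X → none (lose (∈-scalars t) ∉X)

    -- The image forgets v, which is recovered as x - t w; then t determines k.
    R : Vector F n × Fin p → Vector F n × Carrier → Set
    R (v , k) (x , t) = t ≡ others (exceptional v) k × x ≡ v +′ t ·′ w

    total : ∀ {vk} → vk ∈ List.cartesianProduct (List.filter S? (vectors n)) (List.allFin p) →
            ∃ λ y → y ∈ List.cartesianProduct (List.filter X? (vectors n)) scalars × R vk y
    total {v , k} vk∈ =
      let v∈ , _ = ∈-cartesianProduct⁻ (List.filter S? (vectors n)) (List.allFin p) vk∈
          t = others (exceptional v) k
          x∈X = exceptional-spec v (proj₂ (∈-filter⁻ S? {xs = vectors n} v∈)) t (others-≢ _ k)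
      in (v +′ t ·′ w , t) ,
         ∈-cartesianProduct⁺ (∈-filter⁺ X? (∈-vectors _) x∈X) (∈-scalars t) ,
         refl , refl

    injective : ∀ {vk vk′ y} → R vk y → R vk′ y → vk ≡ vk′
    injective {v , k} {v′ , k′} {_ , t} (t≡ , x≡) (t≡′ , x≡′)
      with refl ← +ᵛ-cancelʳ v v′ (t ·′ w) (trans (sym x≡) x≡′)
      = cong (v ,_) (others-injective (exceptional v) (trans (sym t≡) t≡′))

  affine-zero-unique : ∀ {a h} → h ≢ 0# → ∀ {t t′} → a + t * h ≡ 0# → a + t′ * h ≡ 0# → t ≡ t′
  affine-zero-unique {a} h≢0 eq eq′ =
    *-cancelʳ-nonZero h≢0 (+-cancelˡ a _ _ (trans eq (sym eq′)))

  quadratic-+· : ∀ κ x t y → C.quadratic κ (x +′ t ·′ y) ≡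
    C.quadratic κ x + t * C.polar κ x y + t * t * C.quadratic κ y
  quadratic-+· κ@(a ∷ b ∷ c ∷ d ∷ e ∷ f ∷ g ∷ h ∷ i ∷ j ∷ []) x@(_ ∷ _ ∷ _ ∷ _ ∷ []) t y@(_ ∷ _ ∷ _ ∷ _ ∷ []) =
    solve 19 (λ a b c d e f g h i j x₀ x₁ x₂ x₃ y₀ y₁ y₂ y₃ t →
      let κ = a ∷ b ∷ c ∷ d ∷ e ∷ f ∷ g ∷ h ∷ i ∷ j ∷ []
          x = x₀ ∷ x₁ ∷ x₂ ∷ x₃ ∷ []
          y = y₀ ∷ y₁ ∷ y₂ ∷ y₃ ∷ []
      in E.quadratic κ (Vec.zipWith _:+_ x (Vec.map (t :*_) y)) :=
         E.quadratic κ x :+ t :* E.polar κ x y :+ t :* t :* E.quadratic κ y)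
      (κ ++ x ++ y ++ t ∷ [])

  polar-+· : ∀ κ x v t y → C.polar κ x (v +′ t ·′ y) ≡ C.polar κ x v + t * C.polar κ x y
  polar-+· κ@(a ∷ b ∷ c ∷ d ∷ e ∷ f ∷ g ∷ h ∷ i ∷ j ∷ []) x@(_ ∷ _ ∷ _ ∷ _ ∷ []) v@(_ ∷ _ ∷ _ ∷ _ ∷ []) t y@(_ ∷ _ ∷ _ ∷ _ ∷ []) =
    solve 23 (λ a b c d e f g h i j x₀ x₁ x₂ x₃ y₀ y₁ y₂ y₃ v₀ v₁ v₂ v₃ t →
      let κ = a ∷ b ∷ c ∷ d ∷ e ∷ f ∷ g ∷ h ∷ i ∷ j ∷ []
          x = x₀ ∷ x₁ ∷ x₂ ∷ x₃ ∷ []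
          y = y₀ ∷ y₁ ∷ y₂ ∷ y₃ ∷ []
          v = v₀ ∷ v₁ ∷ v₂ ∷ v₃ ∷ []
      in E.polar κ x (Vec.zipWith _:+_ v (Vec.map (t :*_) y)) := E.polar κ x v :+ t :* E.polar κ x y)
      (κ ++ x ++ y ++ v ++ t ∷ [])

  +·-shift : ∀ {n} (v w : Vector F n) t t′ → v +′ t′ ·′ w ≡ (v +′ t ·′ w) +′ (t′ - t) ·′ w
  +·-shift []      []      t t′ = refl
  +·-shift (a ∷ v) (b ∷ w) t t′ = cong₂ _∷_
    (solve 4 (λ a b t t′ → a :+ t′ :* b := a :+ t :* b :+ (t′ :- t) :* b) (a ∷ b ∷ t ∷ t′ ∷ []))
    (+·-shift v w t t′)

  nonZero? : ∀ κ → Decidable (λ v → C.quadratic κ v ≢ 0#)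
  nonZero? κ v = ¬? (C.quadratic κ v ≟ 0#)

  private
    q : ℕ
    q = suc p

    all? : ∀ {n} → Decidable {A = Vector F n} (λ _ → ⊤)
    all? _ = yes tt

    #all : ∀ n → ♯ all? {n} ≡ q ℕ.^ n
    #all n = trans
      (cong List.length (List.filter-all all? {xs = vectors n} (All.universal (λ _ → tt) _)))
      (length-vectors n)

    cancel-q : ∀ a {m} → (q ℕ.* a) ℕ.* p ℕ.≤ m ℕ.* q → a ℕ.* p ℕ.≤ m
    cancel-q a {m} le = ℕ.*-cancelʳ-≤ _ _ q (subst (ℕ._≤ m ℕ.* q)
      (trans (ℕ.*-assoc q a p) (ℕ.*-comm q (a ℕ.* p))) le)

  -- At a zero x the hypothesis removes the polar term, so Q(x + s w) = s² Q(w), which is nonzero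
  -- for s ≠ 0. The lines parallel to w start at all q⁴ vectors.
  nonZero-count-singular : ∀ κ w → C.quadratic κ w ≢ 0# →
    (∀ x y → C.quadratic κ x ≡ 0# → C.polar κ x y ≡ 0#) →
    q ℕ.^ 3 ℕ.* p ℕ.≤ ♯ nonZero? κ
  nonZero-count-singular κ w Qw≢0 singular =
    cancel-q (q ℕ.^ 3) (subst (λ m → m ℕ.* p ℕ.≤ (♯ nonZero? κ) ℕ.* q) (#all 4)
      (lines-count all? (nonZero? κ) w λ v _ t t′ ¬≢ ¬≢′ →
        sym (x∙y⁻¹≈ε⇒x≈y _ _ (zero-shift (v +′ t ·′ w) (t′ - t) (decidable-stable (_ ≟ _) ¬≢)
          (subst (λ u → C.quadratic κ u ≡ 0#) (+·-shift v w t t′) (decidable-stable (_ ≟ _) ¬≢′))))))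
    where
    zero-shift : ∀ x s → C.quadratic κ x ≡ 0# → C.quadratic κ (x +′ s ·′ w) ≡ 0# → s ≡ 0#
    zero-shift x s Qx≡0 eq = decidable-stable (s ≟ 0#) λ s≢0 →
      *-nonZero (*-nonZero s≢0 s≢0) Qw≢0 (begin
        s * s * C.quadratic κ w
          ≡⟨ solve 2 (λ s c → s :* s :* c := :0 :+ s :* :0 :+ s :* s :* c) (s ∷ C.quadratic κ w ∷ []) ⟩
        0# + s * 0# + s * s * C.quadratic κ w          ≡⟨ cong₂ (λ a b → a + s * b + s * s * C.quadratic κ w) Qx≡0 (singular x w Qx≡0) ⟨
        C.quadratic κ x + s * C.polar κ x w + s * s * C.quadratic κ w ≡⟨ quadratic-+· κ x s w ⟨
        C.quadratic κ (x +′ s ·′ w)                    ≡⟨ eq ⟩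
        0#                                             ∎)
      where open ≡-Reasoning

  -- Lines are counted twice. Along y the function B(x,·) is affine with slope B(x,y) ≠ 0, which
  -- gives q³(q - 1) vectors v with B(x,v) ≠ 0. Along x through such a v, Q itself is affine with
  -- slope B(x,v), because Q(x) = 0.
  nonZero-count-nonsingular : ∀ κ {x y} → C.quadratic κ x ≡ 0# → C.polar κ x y ≢ 0# →
    q ℕ.^ 2 ℕ.* p ℕ.* p ℕ.≤ ♯ nonZero? κ
  nonZero-count-nonsingular κ {x} {y} Qx≡0 Bxy≢0 =
    cancel-q (q ℕ.^ 2 ℕ.* p) (ℕ.≤-trans
      (ℕ.*-monoˡ-≤ p (subst (ℕ._≤ ♯ H?) (ℕ.*-assoc q (q ℕ.^ 2) p) #H)) #X)
    where
    H? : Decidable (λ v → C.polar κ x v ≢ 0#)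
    H? v = ¬? (C.polar κ x v ≟ 0#)

    #H : q ℕ.^ 3 ℕ.* p ℕ.≤ ♯ H?
    #H = cancel-q (q ℕ.^ 3) (subst (λ m → m ℕ.* p ℕ.≤ (♯ H?) ℕ.* q) (#all 4)
      (lines-count all? H? y λ v _ t t′ ¬≢ ¬≢′ → affine-zero-unique Bxy≢0
        (trans (sym (polar-+· κ x v t y)) (decidable-stable (_ ≟ _) ¬≢))
        (trans (sym (polar-+· κ x v t′ y)) (decidable-stable (_ ≟ _) ¬≢′))))

    quadratic-line : ∀ v t → C.quadratic κ (v +′ t ·′ x) ≡ C.quadratic κ v + t * C.polar κ x v
    quadratic-line v t = begin
      C.quadratic κ (v +′ t ·′ x)                                     ≡⟨ quadratic-+· κ v t x ⟩
      C.quadratic κ v + t * C.polar κ v x + t * t * C.quadratic κ x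
        ≡⟨ cong₂ (λ a b → C.quadratic κ v + t * a + t * t * b) (polar-sym κ v x) Qx≡0 ⟩
      C.quadratic κ v + t * C.polar κ x v + t * t * 0#
        ≡⟨ solve 2 (λ a t → a :+ t :* t :* :0 := a) (C.quadratic κ v + t * C.polar κ x v ∷ t ∷ []) ⟩
      C.quadratic κ v + t * C.polar κ x v                             ∎
      where
      open ≡-Reasoning
      polar-sym : ∀ κ x y → C.polar κ x y ≡ C.polar κ y x
      polar-sym κ@(a ∷ b ∷ c ∷ d ∷ e ∷ f ∷ g ∷ h ∷ i ∷ j ∷ []) x@(_ ∷ _ ∷ _ ∷ _ ∷ []) y@(_ ∷ _ ∷ _ ∷ _ ∷ []) =
        solve 18 (λ a b c d e f g h i j x₀ x₁ x₂ x₃ y₀ y₁ y₂ y₃ →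
          let κ = a ∷ b ∷ c ∷ d ∷ e ∷ f ∷ g ∷ h ∷ i ∷ j ∷ []
              x = x₀ ∷ x₁ ∷ x₂ ∷ x₃ ∷ []
              y = y₀ ∷ y₁ ∷ y₂ ∷ y₃ ∷ []
          in E.polar κ x y := E.polar κ y x)
          (κ ++ x ++ y)

    #X : (♯ H?) ℕ.* p ℕ.≤ (♯ nonZero? κ) ℕ.* q
    #X = lines-count H? (nonZero? κ) x λ v Bxv≢0 t t′ ¬≢ ¬≢′ → affine-zero-unique Bxv≢0
      (trans (sym (quadratic-line v t)) (decidable-stable (_ ≟ _) ¬≢))
      (trans (sym (quadratic-line v t′)) (decidable-stable (_ ≟ _) ¬≢′))

  nonZero-count : ∀ κ w → C.quadratic κ w ≢ 0# → q ℕ.^ 2 ℕ.* p ℕ.* p ℕ.≤ ♯ nonZero? κ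
  nonZero-count κ w Qw≢0 with ∃ᵛ? (λ x → ∃ᵛ? (λ y → (C.quadratic κ x ≟ 0#) ×-dec ¬? (C.polar κ x y ≟ 0#)))
  ... | yes (x , y , Qx≡0 , Bxy≢0) = nonZero-count-nonsingular κ Qx≡0 Bxy≢0
  ... | no  none = ℕ.≤-trans q²pp≤q³p (nonZero-count-singular κ w Qw≢0
    λ x y Qx≡0 → decidable-stable (_ ≟ _) λ Bxy≢0 → none (x , y , Qx≡0 , Bxy≢0))
    where
    q²pp≤q³p : q ℕ.^ 2 ℕ.* p ℕ.* p ℕ.≤ q ℕ.^ 3 ℕ.* p
    q²pp≤q³p = ℕ.*-monoˡ-≤ p (subst (q ℕ.^ 2 ℕ.* p ℕ.≤_) (ℕ.*-comm (q ℕ.^ 2) q) (ℕ.*-monoʳ-≤ (q ℕ.^ 2) (ℕ.n≤1+n p)))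

-- Row spaces and the behaviour of minors under row operations.

module LinearAlgebra {q} (F : FiniteField q) where
  open FiniteField F hiding (refl; sym; trans; reflexive; zero)
  open FieldArithmetic F
  open Solve F

  lincomb-0 : ∀ {k n} (vs : Vec (Vector F n) k) → C.lincomb (0ᵛ F) vs ≡ 0ᵛ F
  lincomb-0 []       = refl
  lincomb-0 (v ∷ vs) = trans (cong (_ +′_) (lincomb-0 vs)) (0·v+0 v)
    where
    0·v+0 : ∀ {n} (v : Vector F n) → ((0# ·′ v) +′ (0ᵛ F)) ≡ 0ᵛ F
    0·v+0 []      = refl
    0·v+0 (a ∷ v) = cong₂ _∷_ (trans (+-identityʳ _) (zeroˡ a)) (0·v+0 v)

  lincomb-+ : ∀ {k n} (as bs : Vector F k) (vs : Vec (Vector F n) k) →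
              C.lincomb (as +′ bs) vs ≡ ((C.lincomb as vs) +′ (C.lincomb bs vs))
  lincomb-+ {n = n} [] [] [] = 0≡0+0 n
    where
    0≡0+0 : ∀ n → 0ᵛ F {n} ≡ ((0ᵛ F) +′ (0ᵛ F))
    0≡0+0 zero    = refl
    0≡0+0 (suc n) = cong₂ _∷_ (sym (+-identityʳ 0#)) (0≡0+0 n)
  lincomb-+ (a ∷ as) (b ∷ bs) (v ∷ vs) =
    trans (cong (_ +′_) (lincomb-+ as bs vs)) (interchange v (C.lincomb as vs) (C.lincomb bs vs))
    where
    interchange : ∀ {n} (v x y : Vector F n) →
      (((a + b) ·′ v) +′ (x +′ y)) ≡ (((a ·′ v) +′ x) +′ ((b ·′ v) +′ y))
    interchange []      []      []      = refl
    interchange (v ∷ vs) (x ∷ xs) (y ∷ ys) = cong₂ _∷_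
      (solve 5 (λ a b v x y → (a :+ b) :* v :+ (x :+ y) := a :* v :+ x :+ (b :* v :+ y)) (a ∷ b ∷ v ∷ x ∷ y ∷ []))
      (interchange vs xs ys)

  lincomb-· : ∀ {k n} a (bs : Vector F k) (vs : Vec (Vector F n) k) →
              C.lincomb (a ·′ bs) vs ≡ (a ·′ (C.lincomb bs vs))
  lincomb-· {n = n} a [] [] = 0≡a·0 n
    where
    0≡a·0 : ∀ n → 0ᵛ F {n} ≡ (a ·′ (0ᵛ F))
    0≡a·0 zero    = refl
    0≡a·0 (suc n) = cong₂ _∷_ (sym (zeroʳ a)) (0≡a·0 n)
  lincomb-· a (b ∷ bs) (v ∷ vs) =
    trans (cong (_ +′_) (lincomb-· a bs vs)) (distributes v (C.lincomb bs vs))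
    where
    distributes : ∀ {n} (v x : Vector F n) →
      (((a * b) ·′ v) +′ (a ·′ x)) ≡ (a ·′ ((b ·′ v) +′ x))
    distributes []      []      = refl
    distributes (v ∷ vs) (x ∷ xs) = cong₂ _∷_
      (solve 4 (λ a b v x → a :* b :* v :+ a :* x := a :* (b :* v :+ x)) (a ∷ b ∷ v ∷ x ∷ []))
      (distributes vs xs)

  rowSpace-isSubspace : ∀ {k n} (M : Matrix F k n) → IsSubspace F (rowSpace F M)
  rowSpace-isSubspace M = record
    { 0-closed = 0ᵛ F , lincomb-0 M
    ; +-closed = λ { (as , refl) (bs , refl) → (as +′ bs) , lincomb-+ as bs M }
    ; ·-closed = λ { a (bs , refl) → (a ·′ bs) , lincomb-· a bs M }
    }

  infixr 7 _⊙_
  _⊙_ : ∀ {k m n} → Matrix F k m → Matrix F m n → Matrix F k n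
  g ⊙ M = Vec.map (λ r → C.lincomb r M) g

  lincomb-⊙ : ∀ {k m n} (as : Vector F k) (g : Matrix F k m) (M : Matrix F m n) →
              C.lincomb as (g ⊙ M) ≡ C.lincomb (C.lincomb as g) M
  lincomb-⊙ []       []      M = sym (lincomb-0 M)
  lincomb-⊙ (a ∷ as) (r ∷ g) M = begin
    ((a ·′ (C.lincomb r M)) +′ (C.lincomb as (g ⊙ M)))
      ≡⟨ cong₂ (_+′_) (sym (lincomb-· a r M)) (lincomb-⊙ as g M) ⟩
    ((C.lincomb (a ·′ r) M) +′ (C.lincomb (C.lincomb as g) M))
      ≡⟨ lincomb-+ (a ·′ r) (C.lincomb as g) M ⟨
    C.lincomb ((a ·′ r) +′ (C.lincomb as g)) M ∎
    where open ≡-Reasoning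

  rowSpace-⊙ : ∀ {k m n} (g : Matrix F k m) (M : Matrix F m n) → rowSpace F (g ⊙ M) ⊆ rowSpace F M
  rowSpace-⊙ g M (as , refl) = C.lincomb as g , sym (lincomb-⊙ as g M)

  rows∈rowSpace : ∀ {k n} (M : Matrix F k n) i → rowSpace F M (lookup M i)
  rows∈rowSpace M i = unit i , lincomb-unit i M
    where
    unit : ∀ {k} → Fin k → Vector F k
    unit zero    = 1# ∷ 0ᵛ F
    unit (suc i) = 0# ∷ unit i

    1·v+0 : ∀ {n} (v : Vector F n) → ((1# ·′ v) +′ (0ᵛ F)) ≡ v
    1·v+0 []      = refl
    1·v+0 (a ∷ v) = cong₂ _∷_ (trans (+-identityʳ _) (*-identityˡ a)) (1·v+0 v)

    0·v+w : ∀ {n} (v w : Vector F n) → ((0# ·′ v) +′ w) ≡ w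
    0·v+w []      []      = refl
    0·v+w (a ∷ v) (b ∷ w) = cong₂ _∷_ (trans (cong (_+ b) (zeroˡ a)) (+-identityˡ b)) (0·v+w v w)

    lincomb-unit : ∀ {k n} (i : Fin k) (vs : Vec (Vector F n) k) → C.lincomb (unit i) vs ≡ lookup vs i
    lincomb-unit zero    (v ∷ vs) = trans (cong (_ +′_) (lincomb-0 vs)) (1·v+0 v)
    lincomb-unit (suc i) (v ∷ vs) = trans (cong (_ +′_) (lincomb-unit i vs)) (0·v+w v (lookup vs i))

  rowSpace-⊆⇒⊙ : ∀ {k m n} (N : Matrix F k n) (M : Matrix F m n) →
                 rowSpace F N ⊆ rowSpace F M → ∃ λ g → g ⊙ M ≡ N
  rowSpace-⊆⇒⊙ N M N⊆M = rows N λ i → N⊆M (rows∈rowSpace N i)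
    where
    rows : ∀ {k} (N : Matrix F k _) → (∀ i → rowSpace F M (lookup N i)) → ∃ λ g → g ⊙ M ≡ N
    rows []      _  = [] , refl
    rows (r ∷ N) ∈M =
      let as , eq = ∈M zero ; g , eqs = rows N (∈M ∘ suc) in as ∷ g , cong₂ _∷_ eq eqs

  select-lincomb : ∀ {k m n} (cols : Vec (Fin n) m) (as : Vector F k) (vs : Vec (Vector F n) k) →
    Vec.map (lookup (C.lincomb as vs)) cols ≡ C.lincomb as (Vec.map (λ v → Vec.map (lookup v) cols) vs)
  select-lincomb cols []       []       = zeros cols
    where
    zeros : ∀ {m} (cols : Vec (Fin _) m) → Vec.map (lookup (0ᵛ F)) cols ≡ 0ᵛ F
    zeros []         = refl
    zeros (i ∷ cols) = cong₂ _∷_ (Vec.lookup-replicate i 0#) (zeros cols)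
  select-lincomb cols (a ∷ as) (v ∷ vs) =
    trans (entries cols) (cong (_ +′_) (select-lincomb cols as vs))
    where
    w = C.lincomb as vs
    entries : ∀ {m} (cols : Vec (Fin _) m) → Vec.map (lookup ((a ·′ v) +′ w)) cols ≡
              ((a ·′ (Vec.map (lookup v) cols)) +′ (Vec.map (lookup w) cols))
    entries []         = refl
    entries (i ∷ cols) = cong₂ _∷_
      (trans (Vec.lookup-zipWith _+_ i (a ·′ v) w) (cong (_+ _) (Vec.lookup-map i (a *_) v)))
      (entries cols)

  det-⊙ : ∀ (g X : Matrix F 3 3) → det₃ F (g ⊙ X) ≡ det₃ F g * det₃ F X
  det-⊙ ((a ∷ b ∷ c ∷ []) ∷ (d ∷ e ∷ f ∷ []) ∷ (g ∷ h ∷ i ∷ []) ∷ [])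
        ((a′ ∷ b′ ∷ c′ ∷ []) ∷ (d′ ∷ e′ ∷ f′ ∷ []) ∷ (g′ ∷ h′ ∷ i′ ∷ []) ∷ []) =
    solve 18 (λ a b c d e f g h i a′ b′ c′ d′ e′ f′ g′ h′ i′ →
      let x = (a ∷ b ∷ c ∷ []) ∷ (d ∷ e ∷ f ∷ []) ∷ (g ∷ h ∷ i ∷ []) ∷ []
          y = (a′ ∷ b′ ∷ c′ ∷ []) ∷ (d′ ∷ e′ ∷ f′ ∷ []) ∷ (g′ ∷ h′ ∷ i′ ∷ []) ∷ []
      in E.determinant (Vec.map (λ r → E.lincomb r y) x) := E.determinant x :* E.determinant y)
      (a ∷ b ∷ c ∷ d ∷ e ∷ f ∷ g ∷ h ∷ i ∷ a′ ∷ b′ ∷ c′ ∷ d′ ∷ e′ ∷ f′ ∷ g′ ∷ h′ ∷ i′ ∷ [])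

  selectColumns-⊙ : ∀ {k} I (g : Matrix F k 3) (M : Matrix F 3 6) →
                    selectColumns F I (g ⊙ M) ≡ g ⊙ selectColumns F {k = 3} I M
  selectColumns-⊙ I []      M = refl
  selectColumns-⊙ I (r ∷ g) M = cong₂ _∷_ (select-lincomb _ r M) (selectColumns-⊙ I g M)

  minor-⊙ : ∀ I (g : Matrix F 3 3) (M : Matrix F 3 6) → det[_] F I (g ⊙ M) ≡ det₃ F g * det[_] F I M
  minor-⊙ I g M = trans (cong (det₃ F) (selectColumns-⊙ I g M)) (det-⊙ g (selectColumns F I M))

  evaluate-⊙ : ∀ f (g : Matrix F 3 3) (M : Matrix F 3 6) →
               evaluate F f (g ⊙ M) ≡ det₃ F g * evaluate F f M
  evaluate-⊙ f g M = scale (allKSubsets 3 6)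
    where
    scale : ∀ Is → sumᴸ F (List.map (λ I → f I * det[_] F I (g ⊙ M)) Is) ≡
                   det₃ F g * sumᴸ F (List.map (λ I → f I * det[_] F I M) Is)
    scale []       = sym (zeroʳ _)
    scale (I ∷ Is) = trans (cong₂ _+_ (cong (f I *_) (minor-⊙ I g M)) (scale Is))
      (solve 4 (λ c d m s → c :* (d :* m) :+ d :* s := d :* (c :* m :+ s))
        (f I ∷ det₃ F g ∷ det[_] F I M ∷ sumᴸ F (List.map (λ I → f I * det[_] F I M) Is) ∷ []))

  -- The inclusion gives N = g M, hence f(N) = det(g) f(M).
  evaluate-≢0 : ∀ f {N M : Matrix F 3 6} → rowSpace F N ⊆ rowSpace F M →
                evaluate F f N ≢ 0# → evaluate F f M ≢ 0#
  evaluate-≢0 f {N} {M} N⊆M fN≢0 fM≡0 = let g , gM≡N = rowSpace-⊆⇒⊙ N M N⊆M in fN≢0 (begin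
    evaluate F f N               ≡⟨ cong (evaluate F f) gM≡N ⟨
    evaluate F f (g ⊙ M)         ≡⟨ evaluate-⊙ f g M ⟩
    det₃ F g * evaluate F f M    ≡⟨ cong (det₃ F g *_) fM≡0 ⟩
    det₃ F g * 0#                ≡⟨ zeroʳ _ ⟩
    0#                           ∎)
    where open ≡-Reasoning

-- The two families of maximal singular subspaces and their quadratic forms.

module Generators {q} (F : FiniteField q) where
  open FiniteField F hiding (refl; sym; trans; reflexive; zero)
  open FieldArithmetic F
  open LinearAlgebra F
  open Solve F
  open import Algebra.Properties.Group (CommutativeRing.+-group commutativeRing) using (x∙y⁻¹≈ε⇒x≈y; ⁻¹-injective; ε⁻¹≈ε)

  quadruple : {A : Set} → A → A → A → A → Vec A 4
  quadruple a b c d = a ∷ b ∷ c ∷ d ∷ []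

  lincomb-generator : ∀ b j x as → C.lincomb as (C.generator b j x) ≡ C.ω b x (Vec.insertAt as j 0#)
  lincomb-generator b j x@(_ ∷ _ ∷ _ ∷ _ ∷ []) as@(_ ∷ _ ∷ _ ∷ []) = cases b j
    where
    identity : Bool → Fin 4 → N-ary 7 Expr (Vec Expr 6 × Vec Expr 6)
    identity b j x₀ x₁ x₂ x₃ a₀ a₁ a₂ =
      let x = quadruple x₀ x₁ x₂ x₃ ; as = a₀ ∷ a₁ ∷ a₂ ∷ []
      in E.lincomb as (E.generator b j x) := E.ω b x (Vec.insertAt as j :0)

    -- The normaliser works on closed formulas, so each choice of family and omitted index is an
    -- identity of its own.
    cases : ∀ b j → C.lincomb as (C.generator b j x) ≡ C.ω b x (Vec.insertAt as j 0#)
    cases true  0F = solveVec 7 (identity true  0F) (x ++ as)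
    cases true  1F = solveVec 7 (identity true  1F) (x ++ as)
    cases true  2F = solveVec 7 (identity true  2F) (x ++ as)
    cases true  3F = solveVec 7 (identity true  3F) (x ++ as)
    cases false 0F = solveVec 7 (identity false 0F) (x ++ as)
    cases false 1F = solveVec 7 (identity false 1F) (x ++ as)
    cases false 2F = solveVec 7 (identity false 2F) (x ++ as)
    cases false 3F = solveVec 7 (identity false 3F) (x ++ as)

  -- B(z,z′) is the coefficient of z ∧ z′ in Λ⁴F⁴, and x ∧ u ∧ x ∧ v = 0. Reversing the coordinates
  -- preserves B.
  B-ω : ∀ b x u v → B F (C.ω b x u) (C.ω b x v) ≡ 0#
  B-ω b x@(_ ∷ _ ∷ _ ∷ _ ∷ []) u@(_ ∷ _ ∷ _ ∷ _ ∷ []) v@(_ ∷ _ ∷ _ ∷ _ ∷ []) = cases b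
    where
    identity : Bool → N-ary 12 Expr (Expr × Expr)
    identity b x₀ x₁ x₂ x₃ u₀ u₁ u₂ u₃ v₀ v₁ v₂ v₃ =
      let x = quadruple x₀ x₁ x₂ x₃
      in E.bilinear (E.ω b x (quadruple u₀ u₁ u₂ u₃)) (E.ω b x (quadruple v₀ v₁ v₂ v₃)) := :0

    cases : ∀ b → B F (C.ω b x u) (C.ω b x v) ≡ 0#
    cases true  = solve 12 (identity true) (x ++ u ++ v)
    cases false = solve 12 (identity false) (x ++ u ++ v)

  Q-ω : ∀ b x u → Q F (C.ω b x u) ≡ 0#
  Q-ω b x@(_ ∷ _ ∷ _ ∷ _ ∷ []) u@(_ ∷ _ ∷ _ ∷ _ ∷ []) = cases b
    where
    identity : Bool → N-ary 8 Expr (Expr × Expr)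
    identity b x₀ x₁ x₂ x₃ u₀ u₁ u₂ u₃ =
      E.quadric (E.ω b (quadruple x₀ x₁ x₂ x₃) (quadruple u₀ u₁ u₂ u₃)) := :0

    cases : ∀ b → Q F (C.ω b x u) ≡ 0#
    cases true  = solve 8 (identity true) (x ++ u)
    cases false = solve 8 (identity false) (x ++ u)

  Parallel : ∀ {n} → Vector F n → Vector F n → Set
  Parallel x y = ∀ i j → lookup x i * lookup y j ≡ lookup x j * lookup y i

  ω-zero⇒parallel : ∀ b x y → C.ω b x y ≡ 0ᵛ F → Parallel x y
  ω-zero⇒parallel b x@(_ ∷ _ ∷ _ ∷ _ ∷ []) y@(_ ∷ _ ∷ _ ∷ _ ∷ []) ω≡0 = λ where
      0F 0F → refl
      0F 1F → entry (coordinate 0F)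
      0F 2F → entry (coordinate 1F)
      0F 3F → entry (coordinate 2F)
      1F 0F → sym (entry (coordinate 0F))
      1F 1F → refl
      1F 2F → entry (coordinate 3F)
      -- Coordinate 4F is p₃₁ and not p₁₃, hence the exchanged orientation for this pair.
      1F 3F → sym (entry (coordinate 4F))
      2F 0F → sym (entry (coordinate 1F))
      2F 1F → sym (entry (coordinate 3F))
      2F 2F → refl
      2F 3F → entry (coordinate 5F)
      3F 0F → sym (entry (coordinate 2F))
      3F 1F → entry (coordinate 4F)
      3F 2F → sym (entry (coordinate 5F))
      3F 3F → refl
    where
    entry : ∀ {a b} → a - b ≡ 0# → a ≡ b
    entry = x∙y⁻¹≈ε⇒x≈y _ _

    coordinates : ∀ b → C.ω b x y ≡ 0ᵛ F → ∀ i → lookup (C.wedge x y) i ≡ 0#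
    coordinates true  eq i  = trans (cong (λ z → lookup z i) eq) (Vec.lookup-replicate i 0#)
    coordinates false eq 0F = cong (λ z → lookup z 5F) eq
    coordinates false eq 1F = cong (λ z → lookup z 4F) eq
    coordinates false eq 2F = cong (λ z → lookup z 3F) eq
    coordinates false eq 3F = cong (λ z → lookup z 2F) eq
    coordinates false eq 4F = cong (λ z → lookup z 1F) eq
    coordinates false eq 5F = cong (λ z → lookup z 0F) eq

    coordinate : ∀ i → lookup (C.wedge x y) i ≡ 0#
    coordinate = coordinates b ω≡0

  -- A vanishing combination is x ∧ u = 0 with uⱼ = 0. Then u is parallel to x, so xⱼ uₖ = xₖ uⱼ = 0
  -- for all k.
  generator-independent : ∀ b j x → lookup x j ≢ 0# → LinearlyIndependent F (C.generator b j x)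
  generator-independent b j x xⱼ≢0 as eq = zero-vector as λ k → decidable-stable (_ ≟ _) λ aₖ≢0 →
    *-nonZero xⱼ≢0 aₖ≢0 (begin
      lookup x j * lookup as k                     ≡⟨ cong (lookup x j *_) (Vec.insertAt-punchIn as j 0# k) ⟨
      lookup x j * lookup u (punchIn j k)
        ≡⟨ ω-zero⇒parallel b x u (trans (sym (lincomb-generator b j x as)) eq) j (punchIn j k) ⟩
      lookup x (punchIn j k) * lookup u j          ≡⟨ cong (lookup x (punchIn j k) *_) (Vec.insertAt-lookup as j 0#) ⟩
      lookup x (punchIn j k) * 0#                  ≡⟨ zeroʳ _ ⟩
      0#                                           ∎)
    where
    open ≡-Reasoning
    u = Vec.insertAt as j 0#
    zero-vector : ∀ {n} (v : Vector F n) → (∀ i → lookup v i ≡ 0#) → v ≡ 0ᵛ F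
    zero-vector []      _  = refl
    zero-vector (a ∷ v) v0 = cong₂ _∷_ (v0 zero) (zero-vector v (v0 ∘ suc))

  generator-𝕆 : ∀ b j x → lookup x j ≢ 0# → 𝕆₃,₆ F (rowSpace F (C.generator b j x))
  generator-𝕆 b j x xⱼ≢0 = record
    { isSubspace  = rowSpace-isSubspace (C.generator b j x)
    ; dimension   = C.generator b j x , generator-independent b j x xⱼ≢0 , (λ v∈ → v∈) , (λ v∈ → v∈)
    ; B-isotropic = λ { (as , refl) (bs , refl) → trans
        (cong₂ (B F) (lincomb-generator b j x as) (lincomb-generator b j x bs))
        (B-ω b x (Vec.insertAt as j 0#) (Vec.insertAt bs j 0#)) }
    ; Q-singular  = λ { (as , refl) → trans
        (cong (Q F) (lincomb-generator b j x as)) (Q-ω b x (Vec.insertAt as j 0#)) }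
    }

  ω-shift : ∀ b x u t → C.ω b x (u +′ (t ·′ x)) ≡ C.ω b x u
  ω-shift b x@(_ ∷ _ ∷ _ ∷ _ ∷ []) u@(_ ∷ _ ∷ _ ∷ _ ∷ []) t = cases b
    where
    identity : Bool → N-ary 9 Expr (Vec Expr 6 × Vec Expr 6)
    identity b x₀ x₁ x₂ x₃ u₀ u₁ u₂ u₃ t =
      let x = quadruple x₀ x₁ x₂ x₃ ; u = quadruple u₀ u₁ u₂ u₃
      in E.ω b x (Vec.zipWith _:+_ u (Vec.map (t :*_) x)) := E.ω b x u

    cases : ∀ b → C.ω b x (u +′ (t ·′ x)) ≡ C.ω b x u
    cases true  = solveVec 9 (identity true) (x ++ u ++ t ∷ [])
    cases false = solveVec 9 (identity false) (x ++ u ++ t ∷ [])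

  -- Adding a multiple of x to u leaves x ∧ u unchanged; the multiple -uⱼ / xⱼ makes the omitted
  -- coordinate zero.
  ω∈generator : ∀ b j x → lookup x j ≢ 0# → ∀ u → rowSpace F (C.generator b j x) (C.ω b x u)
  ω∈generator b j x xⱼ≢0 u = Vec.removeAt w j , (begin
    C.lincomb (Vec.removeAt w j) (C.generator b j x)   ≡⟨ lincomb-generator b j x (Vec.removeAt w j) ⟩
    C.ω b x (Vec.insertAt (Vec.removeAt w j) j 0#)     ≡⟨ cong (λ a → C.ω b x (Vec.insertAt (Vec.removeAt w j) j a)) wⱼ≡0 ⟨
    C.ω b x (Vec.insertAt (Vec.removeAt w j) j (lookup w j)) ≡⟨ cong (C.ω b x) (Vec.insertAt-removeAt w j) ⟩
    C.ω b x w                                          ≡⟨ ω-shift b x u t ⟩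
    C.ω b x u                                          ∎)
    where
    open ≡-Reasoning
    r = proj₁ (inverse (lookup x j) xⱼ≢0)
    t = - (lookup u j * r)
    w = (u +′ (t ·′ x))
    wⱼ≡0 : lookup w j ≡ 0#
    wⱼ≡0 = begin
      lookup w j                          ≡⟨ Vec.lookup-zipWith _+_ j u (t ·′ x) ⟩
      lookup u j + lookup (t ·′ x) j  ≡⟨ cong (lookup u j +_) (Vec.lookup-map j (t *_) x) ⟩
      lookup u j + t * lookup x j
        ≡⟨ solve 3 (λ u r x → u :+ (:- (u :* r)) :* x := u :- u :* (x :* r))
             (lookup u j ∷ r ∷ lookup x j ∷ []) ⟩
      lookup u j - lookup u j * (lookup x j * r)
        ≡⟨ cong (λ a → lookup u j - lookup u j * a) (proj₂ (inverse (lookup x j) xⱼ≢0)) ⟩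
      lookup u j - lookup u j * 1#        ≡⟨ solve 1 (λ u → u :- u :* :1 := :0) (lookup u j ∷ []) ⟩
      0#                                  ∎

  wedge₃-ω : ∀ b x u → C.wedge₃ x (C.reversed b (C.ω b x u)) ≡ 0ᵛ F
  wedge₃-ω b x@(_ ∷ _ ∷ _ ∷ _ ∷ []) u@(_ ∷ _ ∷ _ ∷ _ ∷ []) = cases b
    where
    identity : Bool → N-ary 8 Expr (Vec Expr 4 × Vec Expr 4)
    identity b x₀ x₁ x₂ x₃ u₀ u₁ u₂ u₃ =
      let x = quadruple x₀ x₁ x₂ x₃
      in E.wedge₃ x (E.reversed b (E.ω b x (quadruple u₀ u₁ u₂ u₃))) := Vec.replicate 4 :0

    cases : ∀ b → C.wedge₃ x (C.reversed b (C.ω b x u)) ≡ 0ᵛ F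
    cases true  = solveVec 8 (identity true) (x ++ u)
    cases false = solveVec 8 (identity false) (x ++ u)

  -- The coordinates of x ∧ y ∧ eᵢ are, up to sign, coordinates of x ∧ y, and i = 0, 1, 2 already
  -- provide all six.
  wedge₃-zero⇒parallel : ∀ b x y → (∀ u → C.wedge₃ x (C.reversed b (C.ω b y u)) ≡ 0ᵛ F) → Parallel x y
  wedge₃-zero⇒parallel b x@(_ ∷ _ ∷ _ ∷ _ ∷ []) y@(_ ∷ _ ∷ _ ∷ _ ∷ []) zeros =
    ω-zero⇒parallel true x y (trans (cases b) (cong₂ _∷_ (at-e 2F 0F)
      (cong₂ _∷_ (negated (at-e 1F 0F)) (cong₂ _∷_ (negated (at-e 1F 1F))
      (cong₂ _∷_ (at-e 0F 0F) (cong₂ _∷_ (negated (at-e 0F 1F)) (cong₂ _∷_ (at-e 0F 2F) refl)))))))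
    where
    e : Fin 4 → Vector F 4
    e i = 0ᵛ F Vec.[ i ]≔ 1#

    at-e : ∀ i k → lookup (C.wedge₃ x (C.reversed b (C.ω b y (e i)))) k ≡ 0#
    at-e i k = trans (cong (λ z → lookup z k) (zeros (e i))) (Vec.lookup-replicate k 0#)

    negated : ∀ {a} → a ≡ 0# → - a ≡ 0#
    negated refl = ε⁻¹≈ε

    expansion : Bool → N-ary 8 Expr (Vec Expr 6 × Vec Expr 6)
    expansion b x₀ x₁ x₂ x₃ y₀ y₁ y₂ y₃ =
      let x = quadruple x₀ x₁ x₂ x₃ ; y = quadruple y₀ y₁ y₂ y₃
          t = λ i k → lookup (E.wedge₃ x (E.reversed b (E.ω b y (Vec.replicate 4 :0 Vec.[ i ]≔ :1)))) k
      in E.wedge x y := (t 2F 0F ∷ :- t 1F 0F ∷ :- t 1F 1F ∷ t 0F 0F ∷ :- t 0F 1F ∷ t 0F 2F ∷ [])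

    cases : ∀ b → let t = λ i k → lookup (C.wedge₃ x (C.reversed b (C.ω b y (e i)))) k in
      C.wedge x y ≡ t 2F 0F ∷ - t 1F 0F ∷ - t 1F 1F ∷ t 0F 0F ∷ - t 0F 1F ∷ t 0F 2F ∷ []
    cases true  = solveVec 8 (expansion true) (x ++ y)
    cases false = solveVec 8 (expansion false) (x ++ y)

  -- Each y ∧ u lies in W_x and is therefore annihilated by x, so x ∧ y ∧ u = 0 for all u.
  generator-⊆⇒parallel : ∀ b {j k} x y → lookup y k ≢ 0# →
    rowSpace F (C.generator b k y) ⊆ rowSpace F (C.generator b j x) → Parallel x y
  generator-⊆⇒parallel b {j} {k} x y yₖ≢0 sub = wedge₃-zero⇒parallel b x y λ u →
    let as , eq = sub (ω∈generator b k y yₖ≢0 u) in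
    trans (cong (C.wedge₃ x ∘ C.reversed b) (trans (sym eq) (lincomb-generator b j x as)))
          (wedge₃-ω b x (Vec.insertAt as j 0#))

  -- `allKSubsets 3 6` runs lexicographically through 123, 124, ..., 456, the order in which
  -- `coefficients` takes its arguments. Positions such as `# 2` (125) and `# 4` (134) refer to this
  -- order.
  coordinates : Δ₃,₆ F → Vector F 20
  coordinates f = Vec.map f (Vec.fromList (allKSubsets 3 6))

  form : Bool → Δ₃,₆ F → Vector F 4 → Carrier
  form b f = C.quadratic (C.coefficients b (coordinates f))

  -- The value of f depends on the matrix chosen for W_x only through the factor ±xⱼ; for xⱼ ≠ 0 the
  -- quadratic form decides whether f vanishes there.
  evaluate-generator : ∀ f b j x →
    evaluate F f (C.generator b j x) ≡ C.signed j (lookup x j * form b f x)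
  evaluate-generator f b j x@(_ ∷ _ ∷ _ ∷ _ ∷ []) = cases b j
    where
    identity : Bool → Fin 4 → N-ary 24 Expr (Expr × Expr)
    identity b j x₀ x₁ x₂ x₃ c₀ c₁ c₂ c₃ c₄ c₅ c₆ c₇ c₈ c₉ c₁₀ c₁₁ c₁₂ c₁₃ c₁₄ c₁₅ c₁₆ c₁₇ c₁₈ c₁₉ =
      let x = quadruple x₀ x₁ x₂ x₃
          c = c₀ ∷ c₁ ∷ c₂ ∷ c₃ ∷ c₄ ∷ c₅ ∷ c₆ ∷ c₇ ∷ c₈ ∷ c₉ ∷
              c₁₀ ∷ c₁₁ ∷ c₁₂ ∷ c₁₃ ∷ c₁₄ ∷ c₁₅ ∷ c₁₆ ∷ c₁₇ ∷ c₁₈ ∷ c₁₉ ∷ []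
      in E.combination c (E.generator b j x) :=
         E.signed j (lookup x j :* E.quadratic (E.coefficients b c) x)

    ρ : Vec Carrier 24
    ρ = x ++ coordinates f

    cases : ∀ b j → evaluate F f (C.generator b j x) ≡ C.signed j (lookup x j * form b f x)
    cases true  0F = solve 24 (identity true  0F) ρ
    cases true  1F = solve 24 (identity true  1F) ρ
    cases true  2F = solve 24 (identity true  2F) ρ
    cases true  3F = solve 24 (identity true  3F) ρ
    cases false 0F = solve 24 (identity false 0F) ρ
    cases false 1F = solve 24 (identity false 1F) ρ
    cases false 2F = solve 24 (identity false 2F) ρ
    cases false 3F = solve 24 (identity false 3F) ρ

  -‿≢0 : ∀ {a} → a ≢ 0# → - a ≢ 0#
  -‿≢0 a≢0 -a≡0 = a≢0 (⁻¹-injective (trans -a≡0 (sym ε⁻¹≈ε)))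

  signed-≢0 : ∀ j {a} → a ≢ 0# → C.signed j a ≢ 0#
  signed-≢0 0F a≢0 = a≢0
  signed-≢0 1F a≢0 = -‿≢0 a≢0
  signed-≢0 2F a≢0 = a≢0
  signed-≢0 3F a≢0 = -‿≢0 a≢0

  signed-0 : ∀ j → C.signed j 0# ≡ 0#
  signed-0 0F = refl
  signed-0 1F = ε⁻¹≈ε
  signed-0 2F = refl
  signed-0 3F = ε⁻¹≈ε

  evaluate-generator-≢0 : ∀ f b j x → lookup x j ≢ 0# → form b f x ≢ 0# →
                          evaluate F f (C.generator b j x) ≢ 0#
  evaluate-generator-≢0 f b j x xⱼ≢0 fx≢0 = subst (_≢ 0#) (sym (evaluate-generator f b j x))
    (signed-≢0 j (*-nonZero xⱼ≢0 fx≢0))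

  -- A single minor as a combination. The test computes on closed subsets, so `coordinates` of it
  -- reduces to a vector of zeros and ones that the normaliser can match.
  δ : Subset 6 → Δ₃,₆ F
  δ I (J , _) = if does (Vec.≡-dec Bool._≟_ I J) then 1# else 0#

  -- One minor is nonzero on the first subspace and zero on the second, whereas an inclusion would
  -- carry the nonzero value over by `evaluate-≢0`.
  families-disjoint : ∀ j k x y → lookup x j ≢ 0# →
    ¬ (rowSpace F (C.generator true j x) ⊆ rowSpace F (C.generator false k y))
  families-disjoint j k x@(a ∷ b ∷ c ∷ d ∷ []) y@(_ ∷ _ ∷ _ ∷ _ ∷ []) xⱼ≢0 sub =
    evaluate-≢0 (δ (star j)) sub
      (evaluate-generator-≢0 (δ (star j)) true j x xⱼ≢0 (nonZero j xⱼ≢0))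
      (begin
        evaluate F (δ (star j)) (C.generator false k y)            ≡⟨ evaluate-generator (δ (star j)) false k y ⟩
        C.signed k (lookup y k * form false (δ (star j)) y)        ≡⟨ cong (λ t → C.signed k (lookup y k * t)) (vanishes j) ⟩
        C.signed k (lookup y k * 0#)                               ≡⟨ cong (C.signed k) (zeroʳ _) ⟩
        C.signed k 0#                                              ≡⟨ signed-0 k ⟩
        0#                                                         ∎)
    where
    open ≡-Reasoning

    -- The coordinates p_{jk} with k ≠ j; this minor is xⱼ³ up to sign on one family
    -- and vanishes on the other.
    star : Fin 4 → Subset 6
    star 0F = inside  ∷ inside  ∷ inside  ∷ outside ∷ outside ∷ outside ∷ []
    star 1F = inside  ∷ outside ∷ outside ∷ inside  ∷ inside  ∷ outside ∷ []
    star 2F = outside ∷ inside  ∷ outside ∷ inside  ∷ outside ∷ inside  ∷ []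
    star 3F = outside ∷ outside ∷ inside  ∷ outside ∷ inside  ∷ inside  ∷ []

    starᴱ : Fin 4 → Vec Expr 20
    starᴱ j = Vec.replicate 20 :0 Vec.[ position j ]≔ :1
      where
      position : Fin 4 → Fin 20
      position 0F = # 0
      position 1F = # 7
      position 2F = # 14
      position 3F = # 18

    square : Fin 4 → N-ary 4 Expr (Expr × Expr)
    square j x₀ x₁ x₂ x₃ =
      let x = quadruple x₀ x₁ x₂ x₃
      in E.quadratic (E.coefficients true (starᴱ j)) x := E.signed j (lookup x j :* lookup x j)

    squares : ∀ j → form true (δ (star j)) x ≡ C.signed j (lookup x j * lookup x j)
    squares 0F = solve 4 (square 0F) x
    squares 1F = solve 4 (square 1F) x
    squares 2F = solve 4 (square 2F) x
    squares 3F = solve 4 (square 3F) x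

    nonZero : ∀ j → lookup x j ≢ 0# → form true (δ (star j)) x ≢ 0#
    nonZero j xⱼ≢0 = subst (_≢ 0#) (sym (squares j)) (signed-≢0 j (*-nonZero xⱼ≢0 xⱼ≢0))

    zeroForm : Fin 4 → N-ary 4 Expr (Expr × Expr)
    zeroForm j y₀ y₁ y₂ y₃ = E.quadratic (E.coefficients false (starᴱ j)) (quadruple y₀ y₁ y₂ y₃) := :0

    vanishes : ∀ j → form false (δ (star j)) y ≡ 0#
    vanishes 0F = solve 4 (zeroForm 0F) y
    vanishes 1F = solve 4 (zeroForm 1F) y
    vanishes 2F = solve 4 (zeroForm 2F) y
    vanishes 3F = solve 4 (zeroForm 3F) y

-- From nonzero vectors of the two forms to the weight of a codeword.

module WeightBound {p} (F : FiniteField (suc p)) where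
  open FiniteField F hiding (refl; sym; trans; reflexive; zero)
  open FieldArithmetic F
  open Quadrics F
  open LinearAlgebra F
  open Generators F
  open Solve F

  -- The first nonzero entry, with 0# for the zero vector. It tells the q - 1 vectors of one
  -- projective point apart, so no normalised representatives have to be chosen.
  lead : ∀ {n} → Vector F n → Carrier
  lead []      = 0#
  lead (a ∷ v) with a ≟ 0#
  ... | yes _ = lead v
  ... | no  _ = a

  lead-≢0 : ∀ {n} (v : Vector F n) i → lookup v i ≢ 0# → lead v ≢ 0#
  lead-≢0 (a ∷ v) i vᵢ≢0 with a ≟ 0#
  lead-≢0 (a ∷ v) i       vᵢ≢0 | no a≢0  = a≢0
  lead-≢0 (a ∷ v) zero    vᵢ≢0 | yes a≡0 = contradiction a≡0 vᵢ≢0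
  lead-≢0 (a ∷ v) (suc i) vᵢ≢0 | yes _   = lead-≢0 v i vᵢ≢0

  lead-of-0 : ∀ {n} (v : Vector F n) → (∀ i → lookup v i ≡ 0#) → lead v ≡ 0#
  lead-of-0 []      _   = refl
  lead-of-0 (a ∷ v) v≡0 with a ≟ 0#
  ... | yes _   = lead-of-0 v (v≡0 ∘ suc)
  ... | no  a≢0 = contradiction (v≡0 zero) a≢0

  parallel⇒zero : ∀ {n} a (x y : Vector F n) → a ≢ 0# →
                  Parallel (a ∷ x) (0# ∷ y) → ∀ i → lookup y i ≡ 0#
  parallel⇒zero a x y a≢0 x∥y i = *-cancelʳ-nonZero a≢0 (begin
    lookup y i * a  ≡⟨ *-comm _ a ⟩
    a * lookup y i  ≡⟨ x∥y zero (suc i) ⟩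
    lookup x i * 0# ≡⟨ zeroʳ _ ⟩
    0#              ≡⟨ zeroˡ a ⟨
    0# * a          ∎)
    where open ≡-Reasoning

  -- Nonzero parallel vectors have their leading entries at the same place; if both equal a there,
  -- parallelism reads xᵢ a = a yᵢ.
  parallel∧lead⇒≡ : ∀ {n} (x y : Vector F n) → Parallel x y → lead x ≢ 0# → lead x ≡ lead y → x ≡ y
  parallel∧lead⇒≡ []      []      _   _    _  = refl
  parallel∧lead⇒≡ (a ∷ x) (b ∷ y) x∥y lx≢0 eq with a ≟ 0# | b ≟ 0#
  ... | yes refl | yes refl =
    cong (0# ∷_) (parallel∧lead⇒≡ x y (λ i j → x∥y (suc i) (suc j)) lx≢0 eq)
  ... | yes refl | no  b≢0  = contradiction (lead-of-0 x (parallel⇒zero b y x b≢0 λ i j →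
    trans (*-comm _ _) (trans (x∥y j i) (*-comm _ _)))) lx≢0
  ... | no  a≢0  | yes refl = contradiction (trans eq (lead-of-0 y (parallel⇒zero a x y a≢0 x∥y))) lx≢0
  ... | no  a≢0  | no  _    with refl ← eq = cong (a ∷_) (entries x y λ i →
      *-cancelʳ-nonZero a≢0 (trans (x∥y (suc i) zero) (*-comm a _)))
    where
    entries : ∀ {n} (x y : Vector F n) → (∀ i → lookup x i ≡ lookup y i) → x ≡ y
    entries []      []      _   = refl
    entries (a ∷ x) (b ∷ y) x≗y = cong₂ _∷_ (x≗y zero) (entries x y (x≗y ∘ suc))

  form-≢0⇒≢0 : ∀ b f x → form b f x ≢ 0# → ∃ λ j → lookup x j ≢ 0#
  form-≢0⇒≢0 b f x fx≢0 with Fin.any? (λ j → ¬? (lookup x j ≟ 0#))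
  ... | yes xⱼ≢0 = xⱼ≢0
  ... | no  none = contradiction (vanishes (C.coefficients b (coordinates f)) x
      (λ j → decidable-stable (_ ≟ _) λ xⱼ≢0 → none (j , xⱼ≢0))) fx≢0
    where
    vanishes : ∀ κ x → (∀ j → lookup x j ≡ 0#) → C.quadratic κ x ≡ 0#
    vanishes κ@(_ ∷ _ ∷ _ ∷ _ ∷ _ ∷ _ ∷ _ ∷ _ ∷ _ ∷ _ ∷ []) (_ ∷ _ ∷ _ ∷ _ ∷ []) x≡0
      with refl ← x≡0 0F | refl ← x≡0 1F | refl ← x≡0 2F | refl ← x≡0 3F =
      solve 10 (λ a b c d e f g h i j →
        E.quadratic (a ∷ b ∷ c ∷ d ∷ e ∷ f ∷ g ∷ h ∷ i ∷ j ∷ []) (Vec.replicate 4 :0) := :0) κ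

  nonZeroEntry? : Decidable (_≢ 0#)
  nonZeroEntry? a = ¬? (a ≟ 0#)

  lookup-ev : ∀ {n} (L : Vec (Matrix F 3 6) n) f i → lookup (ev F L f) i ≡ evaluate F f (lookup L i)
  lookup-ev L f i = Vec.lookup-map i (evaluate F f) L

  module _ {n} (L : Vec (Matrix F 3 6) n) (reps : IsListOfRepresentatives F L) where
    open IsListOfRepresentatives reps

    Represents : Bool → Vector F 4 → Fin n → Set
    Represents b x i = ∃ λ j → lookup x j ≢ 0# ×
      rowSpace F (lookup L i) ≐ rowSpace F (C.generator b j x)

    representative : ∀ f b x → form b f x ≢ 0# →
      ∃ λ i → Represents b x i × evaluate F f (lookup L i) ≢ 0#
    representative f b x fx≢0 =
      let j , xⱼ≢0 = form-≢0⇒≢0 b f x fx≢0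
          i , L≐G , _ = unique (rowSpace F (C.generator b j x)) (generator-𝕆 b j x xⱼ≢0)
      in i , (j , xⱼ≢0 , L≐G) , evaluate-≢0 f (proj₂ L≐G) (evaluate-generator-≢0 f b j x xⱼ≢0 fx≢0)

    ∈-support : ∀ f i → evaluate F f (lookup L i) ≢ 0# → i ∈ support nonZeroEntry? (ev F L f)
    ∈-support f i ≢0 = ∈-filter⁺ (λ i → nonZeroEntry? (lookup (ev F L f) i)) (∈-allFin i)
      (subst (_≢ 0#) (sym (lookup-ev L f i)) ≢0)

    -- A point x of either projective space is recovered from its subspace up
    -- to a scalar, and then exactly from its leading entry.
    weight-bound : ∀ f →
      ♯ nonZero? (C.coefficients true (coordinates f)) ℕ.+ ♯ nonZero? (C.coefficients false (coordinates f))
        ℕ.≤ hammingWeight F (ev F L f) ℕ.* p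
    weight-bound f = subst₂ ℕ._≤_ length-sources
      (trans (length-cartesianProductWith _,_ (support nonZeroEntry? (ev F L f)) nonZeros)
        (cong₂ ℕ._*_ (length-support nonZeroEntry? (ev F L f)) length-nonZeros))
      (length-≤ R sources-unique total injective)
      where
      κ : Bool → Vector F 10
      κ b = C.coefficients b (coordinates f)

      points : Bool → List (Vector F 4)
      points b = List.filter (nonZero? (κ b)) (vectors 4)

      tagged : Bool → List (Bool × Vector F 4)
      tagged b = List.map (b ,_) (points b)

      sources : List (Bool × Vector F 4)
      sources = tagged true List.++ tagged false

      length-sources : List.length sources ≡ ♯ nonZero? (κ true) ℕ.+ ♯ nonZero? (κ false)
      length-sources = trans (List.length-++ (tagged true))
        (cong₂ ℕ._+_ (length-tagged true) (length-tagged false))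
        where
        length-tagged : ∀ b → List.length (tagged b) ≡ ♯ nonZero? (κ b)
        length-tagged b = List.length-map _ (points b)

      sources-unique : Unique sources
      sources-unique = Unique.++⁺ (tagged-unique true) (tagged-unique false) disjoint
        where
        tagged-unique : ∀ b → Unique (tagged b)
        tagged-unique b = Unique.map⁺ (λ { refl → refl }) (Unique.filter⁺ (nonZero? (κ b)) (vectors-unique 4))

        disjoint : ∀ {s} → ¬ (s ∈ tagged true × s ∈ tagged false)
        disjoint (s∈ , s∈′) with ∈-map⁻ (true ,_) s∈ | ∈-map⁻ (false ,_) s∈′
        ... | _ , _ , refl | _ , _ , ()

      ∈-sources⁻ : ∀ {b x} → (b , x) ∈ sources → form b f x ≢ 0#
      ∈-sources⁻ s∈ with ∈-++⁻ (tagged true) s∈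
      ... | inj₁ s∈₁ with _ , x∈ , refl ← ∈-map⁻ (true ,_) s∈₁ =
        proj₂ (∈-filter⁻ (nonZero? (κ true)) {xs = vectors 4} x∈)
      ... | inj₂ s∈₂ with _ , x∈ , refl ← ∈-map⁻ (false ,_) s∈₂ =
        proj₂ (∈-filter⁻ (nonZero? (κ false)) {xs = vectors 4} x∈)

      R : Bool × Vector F 4 → Fin n × Carrier → Set
      R (b , x) (i , a) = Represents b x i × a ≡ lead x

      total : ∀ {s} → s ∈ sources →
        ∃ λ t → t ∈ List.cartesianProduct (support nonZeroEntry? (ev F L f)) nonZeros × R s t
      total {b , x} s∈ =
        let i , rep@(j , xⱼ≢0 , _) , fL≢0 = representative f b x (∈-sources⁻ s∈)
        in (i , lead x) , ∈-cartesianProduct⁺ (∈-support f i fL≢0) (∈-nonZeros (lead-≢0 x j xⱼ≢0)) , rep , refl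

      injective : ∀ {s s′ t} → R s t → R s′ t → s ≡ s′
      injective {true , x} {false , y} ((j , xⱼ≢0 , L≐) , _) ((k , _ , L≐′) , _) =
        ⊥-elim (families-disjoint j k x y xⱼ≢0 (proj₁ (≐-trans (≐-sym L≐) L≐′)))
      injective {false , y} {true , x} ((k , _ , L≐′) , _) ((j , xⱼ≢0 , L≐) , _) =
        ⊥-elim (families-disjoint j k x y xⱼ≢0 (proj₁ (≐-trans (≐-sym L≐) L≐′)))
      injective {true , x} {true , y} ((j , xⱼ≢0 , L≐) , a≡) ((k , yₖ≢0 , L≐′) , a≡′) =
        cong (true ,_) (parallel∧lead⇒≡ x y
          (generator-⊆⇒parallel true {j} {k} x y yₖ≢0 (proj₁ (≐-trans (≐-sym L≐′) L≐)))
          (lead-≢0 x j xⱼ≢0) (trans (sym a≡) a≡′))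
      injective {false , x} {false , y} ((j , xⱼ≢0 , L≐) , a≡) ((k , yₖ≢0 , L≐′) , a≡′) =
        cong (false ,_) (parallel∧lead⇒≡ x y
          (generator-⊆⇒parallel false {j} {k} x y yₖ≢0 (proj₁ (≐-trans (≐-sym L≐′) L≐)))
          (lead-≢0 x j xⱼ≢0) (trans (sym a≡) a≡′))

-- The parity of q and whether 1 + 1 vanishes.

module Characteristic {q} (F : FiniteField q) where
  open FiniteField F hiding (refl; sym; trans; reflexive; zero)
  open FieldArithmetic F
  open CommutativeRing commutativeRing using (semiring; +-commutativeMonoid; ring; +-group)
  open import Algebra.Properties.CommutativeMonoid.Sum +-commutativeMonoid
    using (sum; sum-permute; ∑-distrib-+; sum-cong-≗; sum-replicate)
  open import Algebra.Properties.Semiring.Mult semiring using (×1-homo-*) renaming (_×_ to infixr 8 _•_)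
  open import Algebra.Properties.Ring ring using (+-cancelˡ)
  open import Algebra.Properties.Group +-group using (//-rightDividesˡ; //-rightDividesʳ)

  -- Adding 1 permutes the field, so that summing all its elements gives
  -- S = S + q · 1.
  q×1≡0 : q • 1# ≡ 0#
  q×1≡0 = +-cancelˡ S _ _ (begin
    S + q • 1#                              ≡⟨ cong (S +_) (sum-replicate q) ⟨
    S + sum {q} (λ _ → 1#)                  ≡⟨ ∑-distrib-+ element (λ _ → 1#) ⟨
    sum (λ i → element i + 1#)              ≡⟨ sum-cong-≗ (λ i → sym (Inverse.strictlyInverseʳ finite (element i + 1#))) ⟩
    sum (λ i → element (shift ⟨$⟩ʳ i))      ≡⟨ sum-permute element shift ⟨
    S                                       ≡⟨ +-identityʳ S ⟨
    S + 0#                                  ∎)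
    where
    open ≡-Reasoning
    element : Fin q → Carrier
    element = Inverse.from finite

    S : Carrier
    S = sum element

    conjugate : (Carrier → Carrier) → Fin q → Fin q
    conjugate g = Inverse.to finite ∘ g ∘ element

    conjugate-inverse : ∀ (g h : Carrier → Carrier) → (∀ a → g (h a) ≡ a) → ∀ i → conjugate g (conjugate h i) ≡ i
    conjugate-inverse g h gh i = begin
      conjugate g (conjugate h i)          ≡⟨ cong (Inverse.to finite ∘ g) (Inverse.strictlyInverseʳ finite (h (element i))) ⟩
      Inverse.to finite (g (h (element i))) ≡⟨ cong (Inverse.to finite) (gh (element i)) ⟩
      Inverse.to finite (element i)        ≡⟨ Inverse.strictlyInverseˡ finite i ⟩
      i                                    ∎

    shift : Permutation′ q
    shift = permutation (conjugate (_+ 1#)) (conjugate (_- 1#))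
      (conjugate-inverse (_+ 1#) (_- 1#) (//-rightDividesˡ 1#))
      (conjugate-inverse (_- 1#) (_+ 1#) (//-rightDividesʳ 1#))

  2×1≡1+1 : 2 • 1# ≡ 1# + 1#
  2×1≡1+1 = cong (1# +_) (+-identityʳ 1#)

  -- From 2 ∣ pᵏ follows p = 2, so q · 1 = 0 is a vanishing product of k factors 1 + 1 in a field.
  even⇒1+1≡0 : IsPrimePower q → 2 ∣ q → 1# + 1# ≡ 0#
  even⇒1+1≡0 (p , k , p-prime , k≥1 , q≡p^k) 2∣q =
    trans (sym 2×1≡1+1) (root k (trans (cong (_• 1#) (trans (cong (ℕ._^ k) 2≡p) (sym q≡p^k))) q×1≡0))
    where
    2∣power : ∀ k → 2 ∣ p ℕ.^ k → 2 ∣ p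
    2∣power zero    2∣1 = contradiction (∣1⇒≡1 2∣1) λ ()
    2∣power (suc k) 2∣  with euclidsLemma p (p ℕ.^ k) prime[2] 2∣
    ... | inj₁ 2∣p  = 2∣p
    ... | inj₂ 2∣pᵏ = 2∣power k 2∣pᵏ

    2≡p : 2 ≡ p
    2≡p with prime⇒irreducible p-prime (2∣power k (subst (2 ∣_) q≡p^k 2∣q))
    ... | inj₂ 2≡p = 2≡p

    root : ∀ k → (2 ℕ.^ k) • 1# ≡ 0# → 2 • 1# ≡ 0#
    root zero    1×1≡0 = contradiction (trans (sym 1×1≡0) (+-identityʳ 1#)) 0≢1
    root (suc k) eq with *-zero-split (trans (sym (×1-homo-* 2 (2 ℕ.^ k))) eq)
    ... | inj₁ 2×1≡0  = 2×1≡0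
    ... | inj₂ 2ᵏ×1≡0 = root k 2ᵏ×1≡0

  -- With q = 1 + 2m, the equation 1 + 1 = 0 would turn q · 1 = 0 into 1 = 0.
  odd⇒1+1≢0 : 2 ∤ q → 1# + 1# ≢ 0#
  odd⇒1+1≢0 2∤q 1+1≡0 with q % 2 in eq | m%n<n q 2
  ... | 0             | _                    = 2∤q (divides (q / 2)
    (trans (m≡m%n+[m/n]*n q 2) (cong (ℕ._+ (q / 2) ℕ.* 2) eq)))
  ... | 1             | _                    = 0≢1 (begin
    0#                                    ≡⟨ q×1≡0 ⟨
    q • 1#                                ≡⟨ cong (_• 1#) (trans (m≡m%n+[m/n]*n q 2) (cong (ℕ._+ (q / 2) ℕ.* 2) eq)) ⟩
    1# + ((q / 2) ℕ.* 2) • 1#             ≡⟨ cong (1# +_) (×1-homo-* (q / 2) 2) ⟩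
    1# + (q / 2) • 1# * 2 • 1#            ≡⟨ cong (λ a → 1# + (q / 2) • 1# * a) (trans 2×1≡1+1 1+1≡0) ⟩
    1# + (q / 2) • 1# * 0#                ≡⟨ cong (1# +_) (zeroʳ _) ⟩
    1# + 0#                               ≡⟨ +-identityʳ 1# ⟩
    1#                                    ∎)
    where open ≡-Reasoning
  ... | suc (suc _)   | ℕ.s≤s (ℕ.s≤s ())

-- Relations among the minors of an isotropic matrix.

module IsotropicMatrices {q} (F : FiniteField q) where
  open FiniteField F hiding (refl; sym; trans; reflexive; zero)
  open FieldArithmetic F
  open Generators F
  open Solve F
  open import Algebra.Properties.Group (CommutativeRing.+-group commutativeRing) using (x∙y⁻¹≈ε⇒x≈y; ⁻¹-injective; ε⁻¹≈ε)

  Isotropic : Matrix F 3 6 → Set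
  Isotropic M = ∀ u t → B F (C.lincomb u M) (C.lincomb t M) ≡ 0#

  ksubset : Fin 20 → KSubset 3 6
  ksubset = List.lookup (allKSubsets 3 6)

  minor : Fin 20 → Matrix F 3 6 → Carrier
  minor k = det[_] F (ksubset k)

  minorᴱ : Fin 20 → Vec (Vec Expr 6) 3 → Expr
  minorᴱ k = E.minor (ksubset k)

  entries : Matrix F 3 6 → Vector F 18
  entries (u ∷ v ∷ w ∷ []) = u ++ v ++ w

  crossForm≡0 : ∀ {M} → Isotropic M → ∀ i j k l → C.crossForm i j k l M ≡ 0#
  crossForm≡0 {M} iso i j k l =
    iso (C.cross (C.column i M) (C.column j M)) (C.cross (C.column k M) (C.column l M))

  -- The pairs of minors {a,b,b′} and {a,c,c′}, where {a,a′}, {b,b′}, {c,c′} are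
  -- the pairs of coordinates with indices summing to 7.
  twins : Fin 6 → Fin 20 × Fin 20
  twins 0F = # 2  , # 4
  twins 1F = # 3  , # 10
  twins 2F = # 6  , # 11
  twins 3F = # 8  , # 13
  twins 4F = # 9  , # 16
  twins 5F = # 15 , # 17

  -- B at the row combinations given by m_a × m_c and m_a × m_c′ is -{a,c,c′}² plus terms symmetric
  -- in the pairs {b,b′} and {c,c′}. Subtracting the same expression with b for c leaves the two
  -- squares.
  twin-squares : ∀ M → Isotropic M → ∀ s → let k , l = twins s in
                 minor k M * minor k M ≡ minor l M * minor l M
  twin-squares M@((_ ∷ _ ∷ _ ∷ _ ∷ _ ∷ _ ∷ []) ∷ (_ ∷ _ ∷ _ ∷ _ ∷ _ ∷ _ ∷ []) ∷
                  (_ ∷ _ ∷ _ ∷ _ ∷ _ ∷ _ ∷ []) ∷ []) iso = λ where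
      0F → equal (prove (relation 0F 1F 2F) (entries M)) (form0 0F 2F 3F) (form0 0F 1F 4F)
      1F → equal (prove (relation 1F 0F 2F) (entries M)) (form0 1F 2F 3F) (form0 1F 0F 5F)
      2F → equal (prove (relation 2F 0F 1F) (entries M)) (form0 2F 1F 4F) (form0 2F 0F 5F)
      3F → equal (prove (relation 3F 0F 1F) (entries M)) (form0 3F 1F 4F) (form0 3F 0F 5F)
      4F → equal (prove (relation 4F 0F 2F) (entries M)) (form0 4F 2F 3F) (form0 4F 0F 5F)
      5F → equal (prove (relation 5F 1F 2F) (entries M)) (form0 5F 2F 3F) (form0 5F 1F 4F)
    where
    form0 : ∀ i j k → C.crossForm i j i k M ≡ 0#
    form0 i j k = crossForm≡0 iso i j i k

    relation : Fin 6 → Fin 6 → Fin 6 → Vec Expr 18 → Expr × Expr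
    relation a b c v =
      let M = E.matrix v ; k , l = twins a
      in minorᴱ k M :* minorᴱ k M :- minorᴱ l M :* minorᴱ l M :=
         E.crossForm a c a (opposite c) M :- E.crossForm a b a (opposite b) M

    equal : ∀ {x y s t} → x - y ≡ s - t → s ≡ 0# → t ≡ 0# → x ≡ y
    equal {x} {y} eq refl refl = x∙y⁻¹≈ε⇒x≈y x y (trans eq (-‿inverseʳ 0#))

  -- r = m₁ × m₂ and s = m₁ × m₃ annihilate three columns when det(m₁,m₂,m₃) = 0.
  twin-sum-zero : ∀ M → Isotropic M → minor (# 0) M ≡ 0# → minor (# 2) M + minor (# 4) M ≡ 0#
  twin-sum-zero M@((_ ∷ _ ∷ _ ∷ _ ∷ _ ∷ _ ∷ []) ∷ (_ ∷ _ ∷ _ ∷ _ ∷ _ ∷ _ ∷ []) ∷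
                   (_ ∷ _ ∷ _ ∷ _ ∷ _ ∷ _ ∷ []) ∷ []) iso p₁₂₃≡0 =
    -- Suppose the sum is nonzero. B at m₁ × m₂ and m₁ × m₄ equals -p₁₂₄ (p₁₂₅ + p₁₃₄), so p₁₂₄ = 0.
    -- Each of p₁₂₅² and p₁₃₄² is minus the sum of a value of B and multiples of p₁₂₄ and p₁₂₃, so
    -- both minors vanish.
    decidable-stable (_ ≟ _) λ f≢0 →
      let p₁₂₄≡0 = cancel f≢0 (prove (product (# 1) 1F 3F) (entries M)) (crossForm≡0 iso 0F 1F 0F 3F)
          p₁₂₅≡0 = root p₁₂₄≡0 (prove (square (# 2) 1F 4F) (entries M)) (crossForm≡0 iso 0F 1F 0F 4F)
          p₁₃₄≡0 = root p₁₂₄≡0 (prove (square (# 4) 2F 3F) (entries M)) (crossForm≡0 iso 0F 2F 0F 3F)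
      in f≢0 (trans (cong₂ _+_ p₁₂₅≡0 p₁₃₄≡0) (+-identityʳ 0#))
    where
    product : Fin 20 → Fin 6 → Fin 6 → Vec Expr 18 → Expr × Expr
    product k i j v =
      let M = E.matrix v
      in minorᴱ k M :* (minorᴱ (# 2) M :+ minorᴱ (# 4) M) := :- E.crossForm 0F i 0F j M

    square : Fin 20 → Fin 6 → Fin 6 → Vec Expr 18 → Expr × Expr
    square k i j v =
      let M = E.matrix v
      in minorᴱ k M :* minorᴱ k M :=
         :- (minorᴱ (# 1) M :* minorᴱ (# 5) M :+ minorᴱ (# 0) M :* minorᴱ (# 7) M
             :+ E.crossForm 0F i 0F j M)

    cancel : ∀ {a b t} → b ≢ 0# → a * b ≡ - t → t ≡ 0# → a ≡ 0#
    cancel {a} {b} b≢0 eq refl = *-cancelʳ-nonZero b≢0 (trans eq (trans ε⁻¹≈ε (sym (zeroˡ b))))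

    root : ∀ {a t} → minor (# 1) M ≡ 0# →
           a * a ≡ - (minor (# 1) M * minor (# 5) M + minor (# 0) M * minor (# 7) M + t) → t ≡ 0# → a ≡ 0#
    root {a} p₁₂₄≡0 eq refl = decidable-stable (_ ≟ _) λ a≢0 → *-nonZero a≢0 a≢0
      (trans eq (trans (cong₂ (λ b c → - (b * minor (# 5) M + c * minor (# 7) M + 0#)) p₁₂₄≡0 p₁₂₃≡0)
        (solve 2 (λ b c → :- (:0 :* b :+ :0 :* c :+ :0) := :0) (minor (# 5) M ∷ minor (# 7) M ∷ []))))

  -- The coefficients are Q(eᵢ) and Q(eᵢ + eⱼ) - Q(eᵢ) - Q(eⱼ), so vanishing as a function suffices
  -- even over the field with two elements.
  quadratic-zero⇒coefficients-zero : ∀ κ → (∀ x → C.quadratic κ x ≡ 0#) → ∀ i → lookup κ i ≡ 0#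
  quadratic-zero⇒coefficients-zero κ@(_ ∷ _ ∷ _ ∷ _ ∷ _ ∷ _ ∷ _ ∷ _ ∷ _ ∷ _ ∷ []) κ≡0 i =
    trans (cong (λ v → lookup v i) (solveVec 10 (λ a b c d e f g h i j →
            polarisation (a ∷ b ∷ c ∷ d ∷ e ∷ f ∷ g ∷ h ∷ i ∷ j ∷ [])) κ))
          (zeros i)
    where
    polarisation : Vec Expr 10 → Vec Expr 10 × Vec Expr 10
    polarisation κ =
      let q₁ = λ i → E.quadratic κ (Vec.replicate 4 :0 Vec.[ i ]≔ :1)
          q₂ = λ i j → E.quadratic κ (Vec.replicate 4 :0 Vec.[ i ]≔ :1 Vec.[ j ]≔ :1) :- q₁ i :- q₁ j
      in κ := (q₁ 0F ∷ q₁ 1F ∷ q₁ 2F ∷ q₁ 3F ∷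
               q₂ 0F 1F ∷ q₂ 0F 2F ∷ q₂ 0F 3F ∷ q₂ 1F 2F ∷ q₂ 1F 3F ∷ q₂ 2F 3F ∷ [])

    e : Fin 4 → Vector F 4
    e i = 0ᵛ F Vec.[ i ]≔ 1#

    q₁ : Fin 4 → Carrier
    q₁ i = C.quadratic κ (e i)

    q₂ : Fin 4 → Fin 4 → Carrier
    q₂ i j = C.quadratic κ (e i Vec.[ j ]≔ 1#) - q₁ i - q₁ j

    q₂≡0 : ∀ i j → q₂ i j ≡ 0#
    q₂≡0 i j = trans (cong₂ (λ a b → a - b - q₁ j) (κ≡0 (e i Vec.[ j ]≔ 1#)) (κ≡0 (e i)))
      (trans (cong (λ a → 0# - 0# - a) (κ≡0 (e j))) (solve 0 (:0 :- :0 :- :0 := :0) []))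

    zeros : ∀ i → lookup (q₁ 0F ∷ q₁ 1F ∷ q₁ 2F ∷ q₁ 3F ∷
                          q₂ 0F 1F ∷ q₂ 0F 2F ∷ q₂ 0F 3F ∷ q₂ 1F 2F ∷ q₂ 1F 3F ∷ q₂ 2F 3F ∷ []) i ≡ 0#
    zeros 0F = κ≡0 (e 0F)
    zeros 1F = κ≡0 (e 1F)
    zeros 2F = κ≡0 (e 2F)
    zeros 3F = κ≡0 (e 3F)
    zeros 4F = q₂≡0 0F 1F
    zeros 5F = q₂≡0 0F 2F
    zeros (suc (suc (suc (suc (suc (suc zero)))))) = q₂≡0 0F 3F
    zeros (suc (suc (suc (suc (suc (suc (suc zero))))))) = q₂≡0 1F 2F
    zeros (suc (suc (suc (suc (suc (suc (suc (suc zero)))))))) = q₂≡0 1F 3F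
    zeros (suc (suc (suc (suc (suc (suc (suc (suc (suc zero))))))))) = q₂≡0 2F 3F

  negation-zero : ∀ {a} → - a ≡ 0# → a ≡ 0#
  negation-zero -a≡0 = ⁻¹-injective (trans -a≡0 (sym ε⁻¹≈ε))

  char2-square-injective : 1# + 1# ≡ 0# → ∀ {a b} → a * a ≡ b * b → a ≡ b
  char2-square-injective 2≡0 {a} {b} a²≡b² = x∙y⁻¹≈ε⇒x≈y a b (decidable-stable (_ ≟ _) λ a-b≢0 →
    *-nonZero a-b≢0 a-b≢0 (begin
      (a - b) * (a - b)
        ≡⟨ solve 2 (λ a b → (a :- b) :* (a :- b) :=
             a :* a :- b :* b :+ (:1 :+ :1) :* (b :* b :- a :* b)) (a ∷ b ∷ []) ⟩
      a * a - b * b + (1# + 1#) * (b * b - a * b) ≡⟨ cong₂ (λ x y → x - b * b + y * (b * b - a * b)) a²≡b² 2≡0 ⟩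
      b * b - b * b + 0# * (b * b - a * b)        ≡⟨ solve 2 (λ x y → x :- x :+ :0 :* y := :0) (b * b ∷ b * b - a * b ∷ []) ⟩
      0#                                          ∎))
    where open ≡-Reasoning

  -- The coefficients agree and 2a = 0. Outside characteristic 2 this gives a = 0; in characteristic
  -- 2, squaring is injective, so m = m′ and the two equal terms cancel.
  twin-terms-zero : ∀ {a a′ m m′} → a + a′ ≡ 0# → a - a′ ≡ 0# → m * m ≡ m′ * m′ → a * m + a′ * m′ ≡ 0#
  twin-terms-zero {a} {a′} {m} {m′} a+a′≡0 a-a′≡0 m²≡m′² with refl ← x∙y⁻¹≈ε⇒x≈y a a′ a-a′≡0 | 1# + 1# ≟ 0#
  ... | yes 2≡0 with refl ← char2-square-injective 2≡0 m²≡m′² = begin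
    a * m + a * m  ≡⟨ solve 2 (λ a m → a :* m :+ a :* m := (a :+ a) :* m) (a ∷ m ∷ []) ⟩
    (a + a) * m    ≡⟨ cong (_* m) a+a′≡0 ⟩
    0# * m         ≡⟨ zeroˡ m ⟩
    0#             ∎
    where open ≡-Reasoning
  ... | no  2≢0 with *-zero-split (trans (solve 1 (λ a → (:1 :+ :1) :* a := a :+ a) (a ∷ [])) a+a′≡0)
  ...   | inj₁ 2≡0  = contradiction 2≡0 2≢0
  ...   | inj₂ refl = solve 2 (λ m m′ → :0 :* m :+ :0 :* m′ := :0) (m ∷ m′ ∷ [])

  -- The 8 triples with one index from each pair {i, 7 - i} have their coefficient alone, up to
  -- sign, in one of the forms. The other 12 make up 6 twin pairs; for each, one form contains the
  -- sum of the two coefficients and the other their difference, up to sign.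
  forms-zero⇒evaluate-zero : ∀ f → (∀ b x → form b f x ≡ 0#) → ∀ M → Isotropic M → evaluate F f M ≡ 0#
  forms-zero⇒evaluate-zero f forms≡0 M iso = trans (prove grouping (coordinates f ++ minors))
    (sum-zero (single (κ⁺ 0F) All.∷ single (κ⁻ 3F) All.∷ single (negation-zero (κ⁻ 2F)) All.∷
      single (negation-zero (κ⁺ 1F)) All.∷ single (κ⁻ 1F) All.∷ single (κ⁺ 2F) All.∷
      single (negation-zero (κ⁺ 3F)) All.∷ single (negation-zero (κ⁻ 0F)) All.∷
      twin 0F (negation-zero (κ⁺ 4F)) (κ⁻ (# 9)) All.∷
      twin 1F (κ⁻ (# 8)) (κ⁺ 5F) All.∷
      twin 2F (κ⁺ (# 6)) (opposite-zero (κ⁻ (# 7))) All.∷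
      twin 3F (negation-zero (κ⁻ (# 6))) (κ⁺ (# 7)) All.∷
      twin 4F (negation-zero (κ⁺ (# 8))) (opposite-zero (κ⁻ 5F)) All.∷
      twin 5F (κ⁻ 4F) (opposite-zero (κ⁺ (# 9))) All.∷ All.[]))
    where
    a : Fin 20 → Carrier
    a k = f (ksubset k)

    m : Fin 20 → Carrier
    m k = minor k M

    minors : Vector F 20
    minors = Vec.map (λ I → det[_] F I M) (Vec.fromList (allKSubsets 3 6))

    κ⁺ : ∀ i → lookup (C.coefficients true (coordinates f)) i ≡ 0#
    κ⁺ = quadratic-zero⇒coefficients-zero (C.coefficients true (coordinates f)) (forms≡0 true)

    κ⁻ : ∀ i → lookup (C.coefficients false (coordinates f)) i ≡ 0#
    κ⁻ = quadratic-zero⇒coefficients-zero (C.coefficients false (coordinates f)) (forms≡0 false)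

    opposite-zero : ∀ {a b} → a - b ≡ 0# → b - a ≡ 0#
    opposite-zero {a} {b} eq = trans (cong (_- a) (sym (x∙y⁻¹≈ε⇒x≈y a b eq))) (-‿inverseʳ a)

    single : ∀ {a m} → a ≡ 0# → a * m ≡ 0#
    single refl = zeroˡ _

    twin : ∀ s → let k , l = twins s in a k + a l ≡ 0# → a k - a l ≡ 0# → a k * m k + a l * m l ≡ 0#
    twin s a+ a- = twin-terms-zero a+ a- (twin-squares M iso s)

    sum-zero : ∀ {xs} → All (_≡ 0#) xs → sumᴸ F xs ≡ 0#
    sum-zero All.[]            = refl
    sum-zero (refl All.∷ xs≡0) = trans (+-identityˡ _) (sum-zero xs≡0)

    grouping : Vec Expr 40 → Expr × Expr
    grouping v =
      let term = λ k → lookup v (k ↑ˡ 20) :* lookup v (20 ↑ʳ k)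
          pair = λ s → term (proj₁ (twins s)) :+ term (proj₂ (twins s))
      in List.foldr _:+_ :0 (List.map term (List.allFin 20)) :=
         List.foldr _:+_ :0 (List.map term (# 0 ∷ # 1 ∷ # 5 ∷ # 7 ∷ # 12 ∷ # 14 ∷ # 18 ∷ # 19 ∷ [])
           List.++ List.map pair (List.allFin 6))

-- The chart p₁₂₃ ≠ 0.

module Chart {q} (F : FiniteField q) where
  open FiniteField F hiding (refl; sym; trans; reflexive; zero)
  open LinearAlgebra F
  open Generators F
  open IsotropicMatrices F
  open Solve F
  open import Algebra.Properties.Group (CommutativeRing.+-group commutativeRing) using (inverseˡ-unique)

  identity₃ : Matrix F 3 3
  identity₃ = (1# ∷ 0# ∷ 0# ∷ []) ∷ (0# ∷ 1# ∷ 0# ∷ []) ∷ (0# ∷ 0# ∷ 1# ∷ []) ∷ []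

  chart : Vector F 3 → Matrix F 3 6
  chart v = C.generator true 0F (1# ∷ v)

  -- Writing N = (I | A), the conditions on Q and B say that A with its columns reversed is
  -- alternating. Three entries remain free, and they are the coordinates 1 to 3 of the point.
  reduced⇒chart : ∀ N → selectColumns F (ksubset (# 0)) N ≡ identity₃ →
    (∀ i → Q F (lookup N i) ≡ 0#) → (∀ i j → B F (lookup N i) (lookup N j) ≡ 0#) →
    ∃ λ v → N ≡ chart v
  reduced⇒chart N@((_ ∷ _ ∷ _ ∷ x₁ ∷ x₂ ∷ x₃ ∷ []) ∷ (_ ∷ _ ∷ _ ∷ y₁ ∷ y₂ ∷ y₃ ∷ []) ∷
                   (_ ∷ _ ∷ _ ∷ z₁ ∷ z₂ ∷ z₃ ∷ []) ∷ []) refl Q≡0 B≡0 =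
    v , trans reduced (sym (chart-entries v))
    where
    v : Vector F 3
    v = y₁ ∷ z₃ ∷ x₂ ∷ []

    ρ : Vector F 9
    ρ = x₁ ∷ x₂ ∷ x₃ ∷ y₁ ∷ y₂ ∷ y₃ ∷ z₁ ∷ z₂ ∷ z₃ ∷ []

    rowᴱ : Vec Expr 9 → Fin 3 → Vec Expr 6
    rowᴱ (x₁ ∷ x₂ ∷ x₃ ∷ y₁ ∷ y₂ ∷ y₃ ∷ z₁ ∷ z₂ ∷ z₃ ∷ []) = λ where
      0F → :1 ∷ :0 ∷ :0 ∷ x₁ ∷ x₂ ∷ x₃ ∷ []
      1F → :0 ∷ :1 ∷ :0 ∷ y₁ ∷ y₂ ∷ y₃ ∷ []
      2F → :0 ∷ :0 ∷ :1 ∷ z₁ ∷ z₂ ∷ z₃ ∷ []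

    Qᴱ : Fin 3 → Fin 9 → Vec Expr 9 → Expr × Expr
    Qᴱ i k ρ = lookup ρ k := E.quadric (rowᴱ ρ i)

    Bᴱ : Fin 3 → Fin 3 → Fin 9 → Fin 9 → Vec Expr 9 → Expr × Expr
    Bᴱ i j k l ρ = lookup ρ k :+ lookup ρ l := E.bilinear (rowᴱ ρ i) (rowᴱ ρ j)

    reduced : N ≡ (1# ∷ 0# ∷ 0# ∷ - z₃ ∷ x₂ ∷ 0# ∷ []) ∷ (0# ∷ 1# ∷ 0# ∷ y₁ ∷ 0# ∷ - x₂ ∷ []) ∷
                  (0# ∷ 0# ∷ 1# ∷ 0# ∷ - y₁ ∷ z₃ ∷ []) ∷ []
    reduced = cong₂ _∷_
      (cong₂ (λ a b → 1# ∷ 0# ∷ 0# ∷ a ∷ x₂ ∷ b ∷ [])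
        (inverseˡ-unique x₁ z₃ (trans (prove (Bᴱ 0F 2F (# 0) (# 8)) ρ) (B≡0 0F 2F)))
        (trans (prove (Qᴱ 0F (# 2)) ρ) (Q≡0 0F)))
      (cong₂ _∷_ (cong₂ (λ a b → 0# ∷ 1# ∷ 0# ∷ y₁ ∷ a ∷ b ∷ [])
        (trans (prove (Qᴱ 1F (# 4)) ρ) (Q≡0 1F))
        (inverseˡ-unique y₃ x₂ (trans (prove (Bᴱ 0F 1F (# 5) (# 1)) ρ) (B≡0 0F 1F))))
      (cong₂ _∷_ (cong₂ (λ a b → 0# ∷ 0# ∷ 1# ∷ a ∷ b ∷ z₃ ∷ [])
        (trans (prove (Qᴱ 2F (# 6)) ρ) (Q≡0 2F))
        (inverseˡ-unique z₂ y₁ (trans (prove (Bᴱ 1F 2F (# 7) (# 3)) ρ) (B≡0 1F 2F)))) refl))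

    chart-entries : ∀ v → let b = lookup v 0F ; c = lookup v 1F ; d = lookup v 2F in
      chart v ≡ (1# ∷ 0# ∷ 0# ∷ - c ∷ d ∷ 0# ∷ []) ∷ (0# ∷ 1# ∷ 0# ∷ b ∷ 0# ∷ - d ∷ []) ∷
                (0# ∷ 0# ∷ 1# ∷ 0# ∷ - b ∷ c ∷ []) ∷ []
    chart-entries v@(_ ∷ _ ∷ _ ∷ []) = cong₂ _∷_
      (solveVec 3 (λ b c d → lookup (E.generator true 0F (:1 ∷ b ∷ c ∷ d ∷ [])) 0F :=
                              (:1 ∷ :0 ∷ :0 ∷ :- c ∷ d ∷ :0 ∷ [])) v)
      (cong₂ _∷_
      (solveVec 3 (λ b c d → lookup (E.generator true 0F (:1 ∷ b ∷ c ∷ d ∷ [])) 1F :=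
                              (:0 ∷ :1 ∷ :0 ∷ b ∷ :0 ∷ :- d ∷ [])) v)
      (cong₂ _∷_
      (solveVec 3 (λ b c d → lookup (E.generator true 0F (:1 ∷ b ∷ c ∷ d ∷ [])) 2F :=
                              (:0 ∷ :0 ∷ :1 ∷ :0 ∷ :- b ∷ c ∷ [])) v)
      refl))

  -- The first three columns form a block X with determinant p₁₂₃; replacing M by X⁻¹M keeps the row
  -- space and makes this block the identity.
  rowSpace-chart : ∀ M → 𝕆₃,₆ F (rowSpace F M) → minor (# 0) M ≢ 0# →
                   ∃ λ v → rowSpace F M ≐ rowSpace F (chart v)
  rowSpace-chart M M∈𝕆 p≢0 =
    let v , N≡chart = reduced⇒chart N N-reduced
          (λ i → Q-singular (rowSpace-⊙ g M (rows∈rowSpace N i)))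
          (λ i j → B-isotropic (rowSpace-⊙ g M (rows∈rowSpace N i)) (rowSpace-⊙ g M (rows∈rowSpace N j)))
    in v , subst (λ N′ → rowSpace F M ≐ rowSpace F N′) N≡chart (M⊆N , rowSpace-⊙ g M)
    where
    open 𝕆₃,₆ M∈𝕆
    d : Carrier
    d = proj₁ (inverse _ p≢0)

    X : Matrix F 3 3
    X = selectColumns F (ksubset (# 0)) M

    dp≡1 : d * det₃ F X ≡ 1#
    dp≡1 = trans (*-comm d _) (proj₂ (inverse _ p≢0))

    g : Matrix F 3 3
    g = C.scaledAdjugate d X

    N : Matrix F 3 6
    N = g ⊙ M

    matrixᴱ : Vec Expr 9 → Vec (Vec Expr 3) 3
    matrixᴱ (a ∷ b ∷ c ∷ d ∷ e ∷ f ∷ g ∷ h ∷ i ∷ []) =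
      (a ∷ b ∷ c ∷ []) ∷ (d ∷ e ∷ f ∷ []) ∷ (g ∷ h ∷ i ∷ []) ∷ []

    adjugate-inverseˡ : ∀ d X → d * det₃ F X ≡ 1# → C.scaledAdjugate d X ⊙ X ≡ identity₃
    adjugate-inverseˡ d ((x₁ ∷ x₂ ∷ x₃ ∷ []) ∷ (y₁ ∷ y₂ ∷ y₃ ∷ []) ∷ (z₁ ∷ z₂ ∷ z₃ ∷ []) ∷ []) eq =
      trans (cong₂ _∷_ (solveVec 10 (row 0F) ρ) (cong₂ _∷_ (solveVec 10 (row 1F) ρ)
              (cong₂ _∷_ (solveVec 10 (row 2F) ρ) refl)))
            (cong (λ a → (a ∷ 0# ∷ 0# ∷ []) ∷ (0# ∷ a ∷ 0# ∷ []) ∷ (0# ∷ 0# ∷ a ∷ []) ∷ []) eq)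
      where
      ρ : Vector F 10
      ρ = d ∷ x₁ ∷ x₂ ∷ x₃ ∷ y₁ ∷ y₂ ∷ y₃ ∷ z₁ ∷ z₂ ∷ z₃ ∷ []

      row : Fin 3 → N-ary 10 Expr (Vec Expr 3 × Vec Expr 3)
      row i d x₁ x₂ x₃ y₁ y₂ y₃ z₁ z₂ z₃ =
        let X = matrixᴱ (x₁ ∷ x₂ ∷ x₃ ∷ y₁ ∷ y₂ ∷ y₃ ∷ z₁ ∷ z₂ ∷ z₃ ∷ [])
        in E.lincomb (lookup (E.scaledAdjugate d X) i) X :=
           (Vec.replicate 3 :0 Vec.[ i ]≔ d :* E.determinant X)

    adjugate-inverseʳ : ∀ d X u → d * det₃ F X ≡ 1# →
      C.lincomb (C.lincomb u X) (C.scaledAdjugate d X) ≡ u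
    adjugate-inverseʳ d ((x₁ ∷ x₂ ∷ x₃ ∷ []) ∷ (y₁ ∷ y₂ ∷ y₃ ∷ []) ∷ (z₁ ∷ z₂ ∷ z₃ ∷ []) ∷ [])
      u@(u₁ ∷ u₂ ∷ u₃ ∷ []) eq = trans
      (solveVec 13 (λ d x₁ x₂ x₃ y₁ y₂ y₃ z₁ z₂ z₃ u₁ u₂ u₃ →
        let X = matrixᴱ (x₁ ∷ x₂ ∷ x₃ ∷ y₁ ∷ y₂ ∷ y₃ ∷ z₁ ∷ z₂ ∷ z₃ ∷ []) ; u = u₁ ∷ u₂ ∷ u₃ ∷ []
        in E.lincomb (E.lincomb u X) (E.scaledAdjugate d X) := Vec.map (d :* E.determinant X :*_) u)
        (d ∷ x₁ ∷ x₂ ∷ x₃ ∷ y₁ ∷ y₂ ∷ y₃ ∷ z₁ ∷ z₂ ∷ z₃ ∷ u₁ ∷ u₂ ∷ u₃ ∷ []))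
      (trans (cong (λ a → Vec.map (a *_) u) eq)
             (cong₂ _∷_ (*-identityˡ u₁) (cong₂ _∷_ (*-identityˡ u₂) (cong₂ _∷_ (*-identityˡ u₃) refl))))

    N-reduced : selectColumns F (ksubset (# 0)) N ≡ identity₃
    N-reduced = trans (selectColumns-⊙ (ksubset (# 0)) g M) (adjugate-inverseˡ d X dp≡1)

    M⊆N : rowSpace F M ⊆ rowSpace F N
    M⊆N (u , refl) = C.lincomb u X ,
      trans (lincomb-⊙ (C.lincomb u X) g M) (cong (λ t → C.lincomb t M) (adjugate-inverseʳ d X u dp≡1))

-- The lower bounds and the codewords that attain them.

module MinimumDistance {p} (F : FiniteField (suc p)) {n} (L : Vec (Matrix F 3 6) n)
                       (reps : IsListOfRepresentatives F L) where
  open FiniteField F hiding (refl; sym; trans; reflexive; zero)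
  open FieldArithmetic F
  open Quadrics F
  open LinearAlgebra F
  open Generators F
  open WeightBound F
  open IsotropicMatrices F
  open Chart F
  open Solve F
  open IsListOfRepresentatives reps
  open ℕ.≤-Reasoning

  private
    q : ℕ
    q = suc p

  1≤p : 1 ℕ.≤ p
  1≤p = nonTrivial finite
    where
    subsingleton : (i j : Fin 1) → i ≡ j
    subsingleton zero zero = refl

    nonTrivial : ∀ {p} → Carrier ↔ Fin (suc p) → 1 ℕ.≤ p
    nonTrivial {zero}  F↔1 = contradiction
      (trans (sym (Inverse.strictlyInverseʳ F↔1 0#))
      (trans (cong (Inverse.from F↔1) (subsingleton _ _)) (Inverse.strictlyInverseʳ F↔1 1#))) 0≢1
    nonTrivial {suc _} _   = ℕ.s≤s ℕ.z≤n

  instance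
    p-nonZero : ℕ.NonZero p
    p-nonZero = ℕ.>-nonZero 1≤p

  isotropic : ∀ i → Isotropic (lookup L i)
  isotropic i u t = 𝕆₃,₆.B-isotropic (sound i) (u , refl) (t , refl)

  weight : Δ₃,₆ F → ℕ
  weight f = hammingWeight F (ev F L f)

  κ : Bool → Δ₃,₆ F → Vector F 10
  κ b f = C.coefficients b (coordinates f)

  ev-≢0 : ∀ f i → evaluate F f (lookup L i) ≢ 0# → ev F L f ≢ 0ᵛ F
  ev-≢0 f i fL≢0 ev≡0 = fL≢0 (trans (sym (lookup-ev L f i))
    (trans (cong (λ x → lookup x i) ev≡0) (Vec.lookup-replicate i 0#)))

  form-≢0⇒ev-≢0 : ∀ f b x → form b f x ≢ 0# → ev F L f ≢ 0ᵛ F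
  form-≢0⇒ev-≢0 f b x fx≢0 = let i , _ , fL≢0 = representative L reps f b x fx≢0 in ev-≢0 f i fL≢0

  forms-zero⇒ev-zero : ∀ f → (∀ b x → form b f x ≡ 0#) → ev F L f ≡ 0ᵛ F
  forms-zero⇒ev-zero f forms≡0 = zero-entries L (λ i →
    forms-zero⇒evaluate-zero f forms≡0 (lookup L i) (isotropic i))
    where
    zero-entries : ∀ {m} (L : Vec (Matrix F 3 6) m) →
      (∀ i → evaluate F f (lookup L i) ≡ 0#) → ev F L f ≡ 0ᵛ F
    zero-entries []      _   = refl
    zero-entries (M ∷ L) M≡0 = cong₂ _∷_ (M≡0 zero) (zero-entries L (M≡0 ∘ suc))

  form-≢0? : ∀ b f → Dec (∃ λ x → form b f x ≢ 0#)
  form-≢0? b f = ∃ᵛ? (nonZero? (κ b f))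

  ¬∃⇒zero : ∀ b f → ¬ (∃ λ x → form b f x ≢ 0#) → ∀ x → form b f x ≡ 0#
  ¬∃⇒zero b f none x = decidable-stable (_ ≟ _) λ fx≢0 → none (x , fx≢0)

  mixed : Bool → Δ₃,₆ F → Fin 6 → Carrier
  mixed b f i = lookup (κ b f) (4 ↑ʳ i)

  -- In characteristic 2 the coefficient of xᵢxⱼ in one form is that of xₖxₗ in
  -- the other, where {i,j,k,l} = {0,1,2,3}.
  mixed-opposite : 1# + 1# ≡ 0# → ∀ f i → mixed true f i ≡ mixed false f (opposite i)
  mixed-opposite 2≡0 f = λ where
      0F → modulo-2 (prove (difference 0F) (coordinates f))
      1F → modulo-2 (prove (difference 1F) (coordinates f))
      2F → modulo-2 (prove (difference 2F) (coordinates f))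
      3F → modulo-2 (prove (difference 3F) (coordinates f))
      4F → modulo-2 (prove (difference 4F) (coordinates f))
      5F → modulo-2 (prove (difference 5F) (coordinates f))
    where
    difference : Fin 6 → Vec Expr 20 → Expr × Expr
    difference i c =
      -- The two coefficients are, up to sign, the sum and the difference of one twin pair, so they
      -- differ by twice one of its members, up to sign.
      let correction = :- lookup c (# 2) ∷ :- lookup c (# 10) ∷ lookup c (# 6) ∷
                       lookup c (# 8) ∷ :- lookup c (# 16) ∷ :- lookup c (# 15) ∷ []
      in lookup (E.coefficients true c) (4 ↑ʳ i) :=
         lookup (E.coefficients false c) (4 ↑ʳ opposite i) :+ (:1 :+ :1) :* lookup correction i

    modulo-2 : ∀ {x y e} → x ≡ y + (1# + 1#) * e → x ≡ y
    modulo-2 {y = y} {e} eq = trans eq (trans (cong (λ t → y + t * e) 2≡0)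
      (solve 2 (λ y e → y :+ :0 :* e := y) (y ∷ e ∷ [])))

  polar-of-squares : 1# + 1# ≡ 0# → ∀ κ → (∀ i → lookup κ (4 ↑ʳ i) ≡ 0#) → ∀ x y → C.polar κ x y ≡ 0#
  polar-of-squares 2≡0 (a ∷ b ∷ c ∷ d ∷ _ ∷ _ ∷ _ ∷ _ ∷ _ ∷ _ ∷ []) β≡0 x@(_ ∷ _ ∷ _ ∷ _ ∷ []) y@(_ ∷ _ ∷ _ ∷ _ ∷ [])
    with refl ← β≡0 0F | refl ← β≡0 1F | refl ← β≡0 2F | refl ← β≡0 3F | refl ← β≡0 4F | refl ← β≡0 5F =
    trans (solve 12 (λ a b c d x₀ x₁ x₂ x₃ y₀ y₁ y₂ y₃ →
        E.polar (a ∷ b ∷ c ∷ d ∷ Vec.replicate 6 :0) (x₀ ∷ x₁ ∷ x₂ ∷ x₃ ∷ []) (y₀ ∷ y₁ ∷ y₂ ∷ y₃ ∷ []) :=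
        (:1 :+ :1) :* (a :* x₀ :* y₀ :+ b :* x₁ :* y₁ :+ c :* x₂ :* y₂ :+ d :* x₃ :* y₃))
        (a ∷ b ∷ c ∷ d ∷ x ++ y))
      (2*-zero _)
    where
    2*-zero : ∀ a → (1# + 1#) * a ≡ 0#
    2*-zero a = trans (cong (_* a) 2≡0) (zeroˡ a)

  polar-zero : 1# + 1# ≡ 0# → ∀ b f → (∀ x → form b f x ≡ 0#) →
               ∀ x y → C.polar (κ (not b) f) x y ≡ 0#
  polar-zero 2≡0 b f form≡0 = polar-of-squares 2≡0 (κ (not b) f) (transferred b zeros)
    where
    zeros : ∀ i → mixed b f i ≡ 0#
    zeros i = quadratic-zero⇒coefficients-zero (κ b f) form≡0 (4 ↑ʳ i)

    transferred : ∀ b → (∀ i → mixed b f i ≡ 0#) → ∀ i → mixed (not b) f i ≡ 0#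
    transferred true  ≡0 i = subst (λ j → mixed false f j ≡ 0#) (Fin.opposite-involutive i)
      (trans (sym (mixed-opposite 2≡0 f (opposite i))) (≡0 (opposite i)))
    transferred false ≡0 i = trans (mixed-opposite 2≡0 f i) (≡0 (opposite i))

  count⁺ count⁻ : Δ₃,₆ F → ℕ
  count⁺ f = ♯ nonZero? (κ true f)
  count⁻ f = ♯ nonZero? (κ false f)

  cancel-p : ∀ a b f → a ℕ.* p ℕ.≤ count⁺ f → b ℕ.* p ℕ.≤ count⁻ f → a ℕ.+ b ℕ.≤ weight f
  cancel-p a b f a≤ b≤ = ℕ.*-cancelʳ-≤ (a ℕ.+ b) (weight f) p (begin
    (a ℕ.+ b) ℕ.* p          ≡⟨ ℕ.*-distribʳ-+ p a b ⟩
    a ℕ.* p ℕ.+ b ℕ.* p      ≤⟨ ℕ.+-mono-≤ a≤ b≤ ⟩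
    count⁺ f ℕ.+ count⁻ f    ≤⟨ weight-bound L reps f ⟩
    weight f ℕ.* p           ∎)

  -- A single nonzero form gives q²(q - 1)² vectors, hence q²(q - 1) points; if both forms vanish,
  -- the codeword is zero.
  odd-lower : ∀ f → ev F L f ≢ 0ᵛ F → q ℕ.^ 2 ℕ.* p ℕ.≤ weight f
  odd-lower f ev≢0 with form-≢0? true f | form-≢0? false f
  ... | yes (w , ≢0) | _            =
    ℕ.≤-trans (ℕ.m≤m+n _ 0) (cancel-p (q ℕ.^ 2 ℕ.* p) 0 f (nonZero-count (κ true f) w ≢0) ℕ.z≤n)
  ... | no _         | yes (w , ≢0) = cancel-p 0 (q ℕ.^ 2 ℕ.* p) f ℕ.z≤n (nonZero-count (κ false f) w ≢0)
  ... | no none⁺     | no none⁻     = contradiction (forms-zero⇒ev-zero f λ where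
    true  → ¬∃⇒zero true f none⁺
    false → ¬∃⇒zero false f none⁻) ev≢0

  even-lower : 1# + 1# ≡ 0# → ∀ f → ev F L f ≢ 0ᵛ F → q ℕ.^ 3 ℕ.≤ weight f
  even-lower 2≡0 f ev≢0 with form-≢0? true f | form-≢0? false f
  ... | yes (w , ≢0) | yes (w′ , ≢0′) = begin
    -- This is `q ^ 3` unfolded; the second inequality sign hides `1≤p`, which gives q² ≤ q²(q - 1)
    -- just before the two counts are used.
    q ℕ.^ 2 ℕ.+ p ℕ.* q ℕ.^ 2             ≡⟨ cong (q ℕ.^ 2 ℕ.+_) (ℕ.*-comm p (q ℕ.^ 2)) ⟩
    q ℕ.^ 2 ℕ.+ q ℕ.^ 2 ℕ.* p             ≤⟨ ℕ.+-monoˡ-≤ _ (ℕ.m≤m*n (q ℕ.^ 2) p) ⟩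
    q ℕ.^ 2 ℕ.* p ℕ.+ q ℕ.^ 2 ℕ.* p       ≤⟨ cancel-p (q ℕ.^ 2 ℕ.* p) (q ℕ.^ 2 ℕ.* p) f
      (nonZero-count (κ true f) w ≢0) (nonZero-count (κ false f) w′ ≢0′) ⟩
    weight f                              ∎
  ... | yes (w , ≢0) | no none      = ℕ.≤-trans (ℕ.m≤m+n _ 0) (cancel-p (q ℕ.^ 3) 0 f (nonZero-count-singular (κ true f) w ≢0
    λ x y _ → polar-zero 2≡0 false f (¬∃⇒zero false f none) x y) ℕ.z≤n)
  ... | no none      | yes (w , ≢0) = cancel-p 0 (q ℕ.^ 3) f ℕ.z≤n (nonZero-count-singular (κ false f) w ≢0
    λ x y _ → polar-zero 2≡0 true f (¬∃⇒zero true f none) x y)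
  ... | no none⁺     | no none⁻     = contradiction (forms-zero⇒ev-zero f λ where
    true  → ¬∃⇒zero true f none⁺
    false → ¬∃⇒zero false f none⁻) ev≢0

  -- Each subspace is listed once, so a position in the support is determined by any chart vector of
  -- its row space.
  weight-≤ : ∀ f vs → (∀ i → evaluate F f (lookup L i) ≢ 0# →
      ∃ λ v → v ∈ vs × rowSpace F (lookup L i) ≐ rowSpace F (chart v)) →
    weight f ℕ.≤ List.length vs
  weight-≤ f vs charted = subst (ℕ._≤ List.length vs) (length-support (nonZeroEntry?) (ev F L f))
    (length-≤ (λ i v → rowSpace F (lookup L i) ≐ rowSpace F (chart v))
      (Unique.filter⁺ _ (Unique.allFin⁺ n))
      (λ {i} i∈ → charted i (subst (_≢ 0#) (lookup-ev L f i)
        (proj₂ (∈-filter⁻ (λ i → nonZeroEntry? (lookup (ev F L f) i)) {xs = List.allFin n} i∈))))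
      λ {i} {j} i≐ j≐ → let _ , _ , only = unique (rowSpace F (lookup L i)) (sound i) in
        trans (sym (only ((λ v∈ → v∈) , λ v∈ → v∈))) (only (≐-trans j≐ (≐-sym i≐))))

  δᴱ : Fin 20 → Vec Expr 20
  δᴱ k = Vec.replicate 20 :0 Vec.[ k ]≔ :1

  minors : Matrix F 3 6 → Vector F 20
  minors M = Vec.map (λ I → det[_] F I M) (Vec.fromList (allKSubsets 3 6))

  pairingᴱ : Vec Expr 20 → Vec Expr 20 → Expr
  pairingᴱ c m = List.foldr _:+_ :0 (Vec.toList (Vec.zipWith _:*_ c m))

  even-codeword : Δ₃,₆ F
  even-codeword = δ (proj₁ (ksubset (# 0)))

  -- Where p₁₂₃ ≠ 0 the subspace lies in the chart, which is parametrised by q³ vectors.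
  even-attained : weight even-codeword ℕ.≤ q ℕ.^ 3
  even-attained = subst (weight even-codeword ℕ.≤_) (length-vectors 3)
    (weight-≤ even-codeword (vectors 3) λ i fL≢0 →
      let v , L≐ = rowSpace-chart (lookup L i) (sound i) (subst (_≢ 0#)
                     (prove (λ m → pairingᴱ (δᴱ (# 0)) m := lookup m (# 0)) (minors (lookup L i))) fL≢0)
      in v , ∈-vectors v , L≐)

  even-nonZero : ev F L even-codeword ≢ 0ᵛ F
  even-nonZero = form-≢0⇒ev-≢0 even-codeword true (1# ∷ 0ᵛ F) (subst (_≢ 0#)
    (sym (solve 0 (E.quadratic (E.coefficients true (δᴱ (# 0))) (:1 ∷ Vec.replicate 3 :0) := :1) []))
    (0≢1 ∘ sym))

  odd-codeword : Δ₃,₆ F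
  odd-codeword I = δ (proj₁ (ksubset (# 2))) I + δ (proj₁ (ksubset (# 4))) I

  odd-form : Vec Expr 4 → Expr
  odd-form = E.quadratic (E.coefficients true (Vec.zipWith _:+_ (δᴱ (# 2)) (δᴱ (# 4))))

  odd-nonZero : 1# + 1# ≢ 0# → ev F L odd-codeword ≢ 0ᵛ F
  odd-nonZero 2≢0 = form-≢0⇒ev-≢0 odd-codeword true (1# ∷ 1# ∷ 0# ∷ 0# ∷ []) (subst (_≢ 0#)
    (sym (solve 0 (odd-form (:1 ∷ :1 ∷ :0 ∷ :0 ∷ []) := :- (:1 :+ :1)) []))
    (-‿≢0 2≢0))

  -- The codeword vanishes outside the chart by `twin-sum-zero`, and at the chart vector (b, c, d)
  -- it is -2b. So b ranges over nonzero scalars, while c and d are free.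
  odd-attained : weight odd-codeword ℕ.≤ p ℕ.* q ℕ.^ 2
  odd-attained = subst (weight odd-codeword ℕ.≤_)
    (trans (length-cartesianProductWith _∷_ nonZeros (vectors 2)) (cong₂ ℕ._*_ length-nonZeros (length-vectors 2)))
    (weight-≤ odd-codeword (List.cartesianProductWith _∷_ nonZeros (vectors 2)) charted)
    where
    charted : ∀ i → evaluate F odd-codeword (lookup L i) ≢ 0# →
      ∃ λ v → v ∈ List.cartesianProductWith _∷_ nonZeros (vectors 2) ×
              rowSpace F (lookup L i) ≐ rowSpace F (chart v)
    charted i fL≢0 = b∷v , ∈-chart b∷v (evaluate-≢0 odd-codeword (proj₁ L≐) fL≢0) , L≐
      where
      M = lookup L i

      p₁₂₃≢0 : minor (# 0) M ≢ 0#
      p₁₂₃≢0 p₁₂₃≡0 = fL≢0 (trans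
        (prove (λ m → pairingᴱ (Vec.zipWith _:+_ (δᴱ (# 2)) (δᴱ (# 4))) m :=
                      lookup m (# 2) :+ lookup m (# 4)) (minors M))
        (twin-sum-zero M (isotropic i) p₁₂₃≡0))

      b∷v = proj₁ (rowSpace-chart M (sound i) p₁₂₃≢0)
      L≐  = proj₂ (rowSpace-chart M (sound i) p₁₂₃≢0)

      ∈-chart : ∀ v → evaluate F odd-codeword (chart v) ≢ 0# →
                v ∈ List.cartesianProductWith _∷_ nonZeros (vectors 2)
      ∈-chart (b ∷ c ∷ d ∷ []) fv≢0 = ∈-cartesianProductWith⁺ _∷_ (∈-nonZeros b≢0) (∈-vectors (c ∷ d ∷ []))
        where
        b≢0 : b ≢ 0#
        b≢0 refl = fv≢0 (trans (evaluate-generator odd-codeword true 0F (1# ∷ 0# ∷ c ∷ d ∷ []))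
          (solve 2 (λ c d → :1 :* odd-form (:1 ∷ :0 ∷ c ∷ d ∷ []) := :0) (c ∷ d ∷ [])))

  -- An upper bound on the weight of f is enough, as the lower bound applies to f itself.
  minimumDistance : ∀ f {d} → ev F L f ≢ 0ᵛ F → weight f ℕ.≤ d →
    (∀ g → ev F L g ≢ 0ᵛ F → d ℕ.≤ weight g) →
    IsMinimumDistance F (polarOrthogonalGrassmannCode F L) d
  minimumDistance f f≢0 ≤d d≤ = record
    { attained   = ev F L f , (f , refl) , f≢0 , ℕ.≤-antisym ≤d (d≤ f f≢0)
    ; lowerBound = λ { (g , refl) g≢0 → d≤ g g≢0 }
    }

  q³∸q²≡pq² : q ℕ.^ 3 ℕ.∸ q ℕ.^ 2 ≡ p ℕ.* q ℕ.^ 2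
  q³∸q²≡pq² = ℕ.m+n∸m≡n (q ℕ.^ 2) (p ℕ.* q ℕ.^ 2)

theorem7p11 : ∀ (q : ℕ) → IsPrimePower q → (F : FiniteField q) →
    ∀ {n : ℕ} (L : Vec (Matrix F 3 6) n) → IsListOfRepresentatives F L →
    (2 ∣ q → IsMinimumDistance F (polarOrthogonalGrassmannCode F L) (q ^ 3)) ×
    (2 ∤ q → IsMinimumDistance F (polarOrthogonalGrassmannCode F L) (q ^ 3 ∸ q ^ 2))
-- 0# is an element, so the field is not in bijection with `Fin 0`; otherwise q = p + 1.
theorem7p11 zero    _       F L _    = contradiction (Inverse.to finite 0#) Fin.¬Fin0
  where open FiniteField F
theorem7p11 (suc p) q-power F L reps =
  (λ 2∣q → minimumDistance even-codeword even-nonZero even-attained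
             (even-lower (even⇒1+1≡0 q-power 2∣q))) ,
  (λ 2∤q → subst (IsMinimumDistance F (polarOrthogonalGrassmannCode F L)) (sym q³∸q²≡pq²)
    (minimumDistance odd-codeword (odd-nonZero (odd⇒1+1≢0 2∤q)) odd-attained
      λ f f≢0 → subst (ℕ._≤ weight f) (ℕ.*-comm (suc p ℕ.^ 2) p) (odd-lower f f≢0)))
  where
  open MinimumDistance F L reps
  open Characteristic F
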